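{- Let $A \subset \mathbb{Z}^d$ be a finite set such that $A - A$ generates $\mathbb{Z}^d$ additively and such that its convex hull $\Delta_A$ is a $d$-dimensional simplex. Denote by $v_1, \ldots, v_{d+1}$ the vertices of $\Delta_A$, and for each $i$ let \[ T_i(A) = \bigcup_{k \geq 0} k(A - v_i), \] where $A - v_i = \{a - v_i : a \in A\}$. Then for all integers $h \geq 0$ with $h \geq \mathrm{vol}(\Delta_A)\cdot (d+1)! - 2 - 2d$ we have \[ hA = \bigcap_{i=1}^{d+1} \big( h v_i + T_i(A) \big). \]
   Context: For a finite set $B \subset \mathbb{Z}^d$ and integer $k \geq 0$, $kB = \{b_1 + \cdots + b_k : b_i \in B\}$, with $0B = \{0\}$. $\mathrm{vol}(\Delta_A)$ is the $d$-dimensional Lebesgue volume of the convex hull of $A$. For a set $S$ and vector $x$, $x + S = \{x + s : s \in S\}$. -}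

module Defs where

open import Algebra.Definitions.RawMonoid using (sum)
open import Data.Fin using (Fin)
open import Data.Integer as ℤ using (ℤ; +_)
open import Data.List as List using (List)
open import Data.List.Membership.Propositional using (_∈_)
open import Data.List.Relation.Unary.Any using (Any)
open import Data.Nat as ℕ using (ℕ; suc)
open import Data.Product using (_×_; ∃-syntax; Σ-syntax)
open import Data.Rational as ℚ using (ℚ; 0ℚ; 1ℚ)
open import Data.Vec as Vec using (Vec; lookup)
open import Data.Vec.Relation.Unary.All using (All)
open import Level using (0ℓ)
open import Relation.Binary.PropositionalEquality using (_≡_)
open import Relation.Unary using (Pred; _≐_; ⋃)

private
  variable
    d m n : ℕ

infixl 6 _+ᵛ_ _-ᵛ_
infixr 6 _+ˢ_
infixl 6 _-ˢ_
infixr 7 _·ᵛ_ _·ˢ_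

0ᵛ : Vec ℤ d
0ᵛ = Vec.replicate _ ℤ.0ℤ

-ᵛ_ : Vec ℤ d → Vec ℤ d
-ᵛ_ = Vec.map (λ a → ℤ.- a)

_+ᵛ_ : Vec ℤ d → Vec ℤ d → Vec ℤ d
_+ᵛ_ = Vec.zipWith ℤ._+_

_-ᵛ_ : Vec ℤ d → Vec ℤ d → Vec ℤ d
_-ᵛ_ = Vec.zipWith ℤ._-_

_·ᵛ_ : ℕ → Vec ℤ d → Vec ℤ d
k ·ᵛ x = Vec.map (+ k ℤ.*_) x

sumᵛ : Vec (Vec ℤ d) n → Vec ℤ d
sumᵛ = Vec.foldr′ _+ᵛ_ 0ᵛ

_+ˢ_ : Vec ℤ d → Pred (Vec ℤ d) 0ℓ → Pred (Vec ℤ d) 0ℓ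
(x +ˢ S) y = ∃[ s ] (S s × y ≡ x +ᵛ s)

_-ˢ_ : Pred (Vec ℤ d) 0ℓ → Vec ℤ d → Pred (Vec ℤ d) 0ℓ
(S -ˢ x) y = ∃[ s ] (S s × y ≡ s -ᵛ x)

Differences : Pred (Vec ℤ d) 0ℓ → Pred (Vec ℤ d) 0ℓ
Differences S y = ∃[ s ] ∃[ t ] (S s × S t × y ≡ s -ᵛ t)

-- The k-fold sumset (not the dilate): sums of k elements, repetitions allowed.
_·ˢ_ : ℕ → Pred (Vec ℤ d) 0ℓ → Pred (Vec ℤ d) 0ℓ
_·ˢ_ {d} k B x = Σ[ b ∈ Vec (Vec ℤ d) k ] (All B b × x ≡ sumᵛ b)

data ⟨_⟩ (S : Pred (Vec ℤ d) 0ℓ) : Pred (Vec ℤ d) 0ℓ where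
  gen  : ∀ {x} → S x → ⟨ S ⟩ x
  zero : ⟨ S ⟩ 0ᵛ
  neg  : ∀ {x} → ⟨ S ⟩ x → ⟨ S ⟩ (-ᵛ x)
  add  : ∀ {x y} → ⟨ S ⟩ x → ⟨ S ⟩ y → ⟨ S ⟩ (x +ᵛ y)

Generates : Pred (Vec ℤ d) 0ℓ → Set
Generates S = ∀ x → ⟨ S ⟩ x

-- A list stands for the finite set of its entries.
⟦_⟧ : List (Vec ℤ d) → Pred (Vec ℤ d) 0ℓ
⟦ A ⟧ x = x ∈ A

T : List (Vec ℤ d) → Vec ℤ d → Pred (Vec ℤ d) 0ℓ
T A v = ⋃[ k ∶ ℕ ] (k ·ˢ (⟦ A ⟧ -ˢ v))

-- All geometry is carried out on rational points.  Convex hulls of integer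
-- points are rational polytopes, each the closure of its set of rational
-- points.  Hence two such hulls agree over ℝ iff they agree over ℚ, and affine
-- independence of integer points over ℝ and over ℚ are the same.

fromℤ : ℤ → ℚ
fromℤ z = z ℚ./ 1

ι : Vec ℤ d → Vec ℚ d
ι = Vec.map fromℤ

Σℚ Πℚ : (Fin n → ℚ) → ℚ
Σℚ = sum ℚ.+-0-rawMonoid
Πℚ = sum ℚ.*-1-rawMonoid

Conv : (Fin n → Vec ℚ d) → Pred (Vec ℚ d) 0ℓ
Conv {n} {d} p x =
  Σ[ w ∈ (Fin n → ℚ) ]
    ((∀ i → 0ℚ ℚ.≤ w i)
    × Σℚ w ≡ 1ℚ
    × (∀ (j : Fin d) → Σℚ (λ i → w i ℚ.* lookup (p i) j) ≡ lookup x j))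

AffinelyIndependent : (Fin n → Vec ℚ d) → Set
AffinelyIndependent {n} {d} p =
  (c : Fin n → ℚ) →
  Σℚ c ≡ 0ℚ →
  (∀ (j : Fin d) → Σℚ (λ i → c i ℚ.* lookup (p i) j) ≡ 0ℚ) →
  ∀ i → c i ≡ 0ℚ

Δ : List (Vec ℤ d) → Pred (Vec ℚ d) 0ℓ
Δ A = Conv (λ i → ι (List.lookup A i))

-- K is an m-dimensional simplex whose vertices are the p i.
IsSimplex : Pred (Vec ℚ d) 0ℓ → (Fin (suc m) → Vec ℚ d) → Set
IsSimplex K p = AffinelyIndependent p × K ≐ Conv p

record Box (d : ℕ) : Set where
  field
    lower upper : Fin d → ℚ
    lower≤upper : ∀ j → lower j ℚ.≤ upper j

open Box public

_∈ᴮ_ : Vec ℚ d → Box d → Set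
x ∈ᴮ B = ∀ j → lower B j ℚ.≤ lookup x j × lookup x j ℚ.≤ upper B j

boxVolume : Box d → ℚ
boxVolume B = Πℚ (λ j → upper B j ℚ.- lower B j)

totalVolume : List (Box d) → ℚ
totalVolume Bs = List.foldr ℚ._+_ 0ℚ (List.map boxVolume Bs)

Covers : List (Box d) → Pred (Vec ℚ d) 0ℓ → Set
Covers Bs K = ∀ x → K x → Any (x ∈ᴮ_) Bs

-- Lebesgue measure is the infimum of the total volumes of countable covers by
-- boxes.  For a compact set in ℝᵈ finite covers by closed rational boxes give
-- the same infimum (enlarge the boxes slightly to open ones and extract a
-- finite subcover).  If the set is moreover the closure of its rational points
-- K, such a finite family covers it as soon as it covers K, its union being
-- closed.  So for K = Δ A, IsVolume K v says that v is the d-dimensional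
-- Lebesgue volume of the convex hull of A in ℝᵈ; when that hull is a simplex
-- the volume is rational, so a v : ℚ with this property exists (classically)
-- and is unique.
IsVolume : Pred (Vec ℚ d) 0ℓ → ℚ → Set
IsVolume {d} K v =
  (∀ Bs → Covers Bs K → v ℚ.≤ totalVolume Bs)
  × (∀ ε → 0ℚ ℚ.< ε →
      Σ[ Bs ∈ List (Box d) ] (Covers Bs K × totalVolume Bs ℚ.≤ v ℚ.+ ε))

module Submission where

-- Homogenise every point a of A to (1, a) and let Λ be the lattice spanned by the homogenised
-- vertices.  If x lies in all the sets h·vᵢ + T(A, vᵢ), then for each i the point (h, x) is a sum
-- of a sequence S of homogenised elements of A plus an integral combination Σ cⱼ (1, vⱼ) with
-- cⱼ ≥ 0 for j ≠ i.  Two partial sums of S which are congruent modulo Λ enclose a block whose sum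
-- is a nonnegative integral combination of vertices, so S can be shortened until its partial sums
-- are pairwise incongruent.  Translating these 1 + |S| partial sums by the points of Λ at a fixed
-- large height gives distinct lattice points in a dilate of the simplex; comparing their number
-- with the volume of the boxes of a cover yields 1 + |S| ≤ d!·vol.  Taking for i the largest
-- barycentric coordinate of (h, x), this bound on |S| forces cᵢ ≥ 0 as well, whence x ∈ hA.

-- The constant arises as follows. Let L be M times the barycentric coordinates of (h, x), with M a
-- common denominator for the points of A. The entries of L sum to M·h, so the largest one, at i,
-- satisfies M·h ≤ (d+1)·Lᵢ, and Lᵢ is the contribution of S plus M·cᵢ. Each point of S contributes
-- at most M, and a point contributing M would be a vertex, which is congruent to 0 and cannot occur
-- in S. For nonempty S, cᵢ ≤ -1 would thus give h < (d+1)(|S| - 1), against (d+1)(|S| + 1) ≤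
-- (d+1)!·vol ≤ h + 2(d+1). One subtracted d+1 pays for the empty partial sum, the other for cᵢ ≤
-- -1. The volume is accessible only through box covers, so no determinant or index of Λ is
-- computed. Instead |S| + 1 disjoint families of about mᵈ/d! lattice points each are counted
-- against the lattice points of the dilated boxes, and leading coefficients in m are compared. The
-- final sum lies in hA only if the vertices are elements of A; this is extracted from their
-- extremality.

open import Defs
import Algebra.Properties.Semiring.Sum as SemiringSum
open import Algebra.Bundles using (CommutativeRing)
open import Data.Empty using (⊥-elim)
open import Data.Fin as Fin using (Fin; zero; suc; toℕ)
import Data.Fin.Properties as Fin
open import Data.Integer as ℤ using (ℤ; +_; +≤+; +<+)
import Data.Integer.DivMod as ℤ
open import Data.Integer.Divisibility.Signed using (_∣_; divides; quotient; _∣?_)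
import Data.Integer.Properties as ℤ
import Data.Integer.Tactic.RingSolver as ℤ-Solver
open import Data.List as List using (List; []; _∷_; _++_; length; take; drop)
open import Data.List.Membership.Propositional using (_∈_)
open import Data.List.Membership.Propositional.Properties
  using (∈-map⁺; ∈-map⁻; ∈-upTo⁺; ∈-cartesianProductWith⁺; ∈-++⁺ˡ; ∈-++⁺ʳ; ∈-lookup)
import Data.List.Properties as List
open import Data.List.Relation.Unary.All as All using (All; []; _∷_)
import Data.List.Relation.Unary.All.Properties as All
open import Data.List.Relation.Unary.AllPairs using ([]; _∷_)
open import Data.List.Relation.Unary.Any as Any using (Any; here; there)
import Data.List.Relation.Unary.Any.Properties as Any
open import Data.List.Relation.Unary.Unique.Propositional using (Unique)
import Data.List.Relation.Unary.Unique.Propositional.Properties as Unique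
open import Data.Nat as ℕ using (ℕ; zero; suc; _*_; _!; z≤n; s≤s; NonZero)
open import Data.Nat.Induction using (<-wellFounded)
import Data.Nat.Properties as ℕ
import Data.Nat.Tactic.RingSolver as ℕ-Solver
open import Data.Product using (_×_; _,_; proj₁; proj₂; Σ-syntax; ∃-syntax)
open import Data.Rational as ℚ using (ℚ; 0ℚ; 1ℚ; ↥_; ↧_; ↧ₙ_; *≤*)
import Data.Rational.Properties as ℚ
open import Data.Rational.Unnormalised as ℚᵘ using (mkℚᵘ)
import Data.Rational.Unnormalised.Properties as ℚᵘ
open import Data.Sum using (_⊎_; inj₁; inj₂)
open import Data.Vec as Vec using (Vec; []; _∷_; lookup)
import Data.Vec.Properties as Vec
open import Data.Vec.Relation.Unary.All as VecAll using ([]; _∷_)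
import Data.Vec.Relation.Unary.All.Properties as VecAll
open import Function using (_∘_)
open import Induction.WellFounded using (Acc; acc)
open import Level using (0ℓ)
open import Relation.Binary.Definitions using (tri<; tri≈; tri>)
open import Relation.Binary.PropositionalEquality
open import Relation.Nullary using (¬_; yes; no; contradiction)
open import Relation.Nullary.Decidable using (_×-dec_; ¬?; dec⇒maybe; decidable-stable)
open import Relation.Unary using (_≐_; ⋂)
import Tactic.RingSolver as Solver
import Tactic.RingSolver.Core.AlmostCommutativeRing as ACR

-- Integers inside ℚ

ℚ-ring : ACR.AlmostCommutativeRing 0ℓ 0ℓ
ℚ-ring = ACR.fromCommutativeRing ℚ.+-*-commutativeRing (λ q → dec⇒maybe (0ℚ ℚ.≟ q))

module Σℤ = SemiringSum (CommutativeRing.semiring ℤ.+-*-commutativeRing)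
module Σq = SemiringSum (CommutativeRing.semiring ℚ.+-*-commutativeRing)

-- Opaque, since fromℤ z unfolds to a normalised fraction.
opaque
  toℚ : ℤ → ℚ
  toℚ = fromℤ

  fromℤ≡toℚ : ∀ z → fromℤ z ≡ toℚ z
  fromℤ≡toℚ z = refl

  toℚᵘ-toℚ : ∀ z → ℚ.toℚᵘ (toℚ z) ℚᵘ.≃ mkℚᵘ z 0
  toℚᵘ-toℚ z = ℚ.toℚᵘ-fromℚᵘ (mkℚᵘ z 0)

0≡toℚ : 0ℚ ≡ toℚ (+ 0)
0≡toℚ = fromℤ≡toℚ (+ 0)

1≡toℚ : 1ℚ ≡ toℚ (+ 1)
1≡toℚ = fromℤ≡toℚ (+ 1)

toℚ-+ : ∀ a b → toℚ (a ℤ.+ b) ≡ toℚ a ℚ.+ toℚ b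
toℚ-+ a b = ℚ.toℚᵘ-injective (begin
  ℚ.toℚᵘ (toℚ (a ℤ.+ b))                    ≈⟨ toℚᵘ-toℚ (a ℤ.+ b) ⟩
  mkℚᵘ (a ℤ.+ b) 0                            ≡⟨ cong₂ (λ x y → mkℚᵘ (x ℤ.+ y) 0) (ℤ.*-identityʳ a) (ℤ.*-identityʳ b) ⟨
  mkℚᵘ a 0 ℚᵘ.+ mkℚᵘ b 0                      ≈⟨ ℚᵘ.+-cong (toℚᵘ-toℚ a) (toℚᵘ-toℚ b) ⟨
  ℚ.toℚᵘ (toℚ a) ℚᵘ.+ ℚ.toℚᵘ (toℚ b)      ≈⟨ ℚ.toℚᵘ-homo-+ (toℚ a) (toℚ b) ⟨
  ℚ.toℚᵘ (toℚ a ℚ.+ toℚ b)                ∎)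
  where open ℚᵘ.≃-Reasoning

toℚ-* : ∀ a b → toℚ (a ℤ.* b) ≡ toℚ a ℚ.* toℚ b
toℚ-* a b = ℚ.toℚᵘ-injective (begin
  ℚ.toℚᵘ (toℚ (a ℤ.* b))                    ≈⟨ toℚᵘ-toℚ (a ℤ.* b) ⟩
  mkℚᵘ a 0 ℚᵘ.* mkℚᵘ b 0                      ≈⟨ ℚᵘ.*-cong (toℚᵘ-toℚ a) (toℚᵘ-toℚ b) ⟨
  ℚ.toℚᵘ (toℚ a) ℚᵘ.* ℚ.toℚᵘ (toℚ b)      ≈⟨ ℚ.toℚᵘ-homo-* (toℚ a) (toℚ b) ⟨
  ℚ.toℚᵘ (toℚ a ℚ.* toℚ b)                ∎)
  where open ℚᵘ.≃-Reasoning

toℚ-mono-≤ : ∀ {a b} → a ℤ.≤ b → toℚ a ℚ.≤ toℚ b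
toℚ-mono-≤ {a} {b} a≤b = ℚ.toℚᵘ-cancel-≤
  (ℚᵘ.≤-respˡ-≃ (ℚᵘ.≃-sym (toℚᵘ-toℚ a)) (ℚᵘ.≤-respʳ-≃ (ℚᵘ.≃-sym (toℚᵘ-toℚ b))
    (ℚᵘ.*≤* (ℤ.*-monoʳ-≤-nonNeg (+ 1) a≤b))))

toℚ-cancel-≤ : ∀ {a b} → toℚ a ℚ.≤ toℚ b → a ℤ.≤ b
toℚ-cancel-≤ {a} {b} a≤b = ℤ.*-cancelʳ-≤-pos a b (+ 1)
  (ℚᵘ.drop-*≤* (ℚᵘ.≤-respˡ-≃ (toℚᵘ-toℚ a) (ℚᵘ.≤-respʳ-≃ (toℚᵘ-toℚ b) (ℚ.toℚᵘ-mono-≤ a≤b))))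

toℚ-injective : ∀ {a b} → toℚ a ≡ toℚ b → a ≡ b
toℚ-injective eq =
  ℤ.≤-antisym (toℚ-cancel-≤ (ℚ.≤-reflexive eq)) (toℚ-cancel-≤ (ℚ.≤-reflexive (sym eq)))

toℚ-cancel-< : ∀ {a b} → toℚ a ℚ.< toℚ b → a ℤ.< b
toℚ-cancel-< a<b = ℤ.≰⇒> λ b≤a → ℚ.<-irrefl refl (ℚ.<-≤-trans a<b (toℚ-mono-≤ b≤a))

toℚ-mono-< : ∀ {a b} → a ℤ.< b → toℚ a ℚ.< toℚ b
toℚ-mono-< a<b = ℚ.≰⇒> λ b≤a → ℤ.<-irrefl refl (ℤ.<-≤-trans a<b (toℚ-cancel-≤ b≤a))

toℚ-suc : ∀ z → toℚ (z ℤ.+ + 1) ≡ toℚ z ℚ.+ 1ℚ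
toℚ-suc z = trans (toℚ-+ z (+ 1)) (cong (toℚ z ℚ.+_) (sym 1≡toℚ))

fromℕ : ℕ → ℚ
fromℕ n = toℚ (+ n)

fromℕ-+ : ∀ a b → fromℕ (a ℕ.+ b) ≡ fromℕ a ℚ.+ fromℕ b
fromℕ-+ a b = toℚ-+ (+ a) (+ b)

fromℕ-* : ∀ a b → fromℕ (a ℕ.* b) ≡ fromℕ a ℚ.* fromℕ b
fromℕ-* a b = trans (cong toℚ (ℤ.pos-* a b)) (toℚ-* (+ a) (+ b))

fromℕ-mono-≤ : ∀ {a b} → a ℕ.≤ b → fromℕ a ℚ.≤ fromℕ b
fromℕ-mono-≤ {a} {b} a≤b = toℚ-mono-≤ {+ a} {+ b} (+≤+ a≤b)

0≤fromℕ : ∀ n → 0ℚ ℚ.≤ fromℕ n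
0≤fromℕ n = subst (ℚ._≤ fromℕ n) (sym 0≡toℚ) (fromℕ-mono-≤ {0} {n} z≤n)

fromℕ-positive : ∀ n .{{_ : NonZero n}} → ℚ.Positive (fromℕ n)
fromℕ-positive (suc n) = ℚ.positive (subst (ℚ._< fromℕ (suc n)) (sym 0≡toℚ) (toℚ-mono-< {+ 0} {+ suc n} (+<+ (s≤s z≤n))))

toℚ-sum : ∀ {n} (f : Fin n → ℤ) → toℚ (Σℤ.sum f) ≡ Σℚ (toℚ ∘ f)
toℚ-sum {zero}  f = sym 0≡toℚ
toℚ-sum {suc n} f = trans (toℚ-+ (f zero) _) (cong (toℚ (f zero) ℚ.+_) (toℚ-sum (f ∘ suc)))

↧*p≡↥ : ∀ p → toℚ (↧ p) ℚ.* p ≡ toℚ (↥ p)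
↧*p≡↥ p@record{} = ℚ.toℚᵘ-injective (begin
  ℚ.toℚᵘ (toℚ (↧ p) ℚ.* p)            ≈⟨ ℚ.toℚᵘ-homo-* (toℚ (↧ p)) p ⟩
  ℚ.toℚᵘ (toℚ (↧ p)) ℚᵘ.* ℚ.toℚᵘ p    ≈⟨ ℚᵘ.*-congʳ (toℚᵘ-toℚ (↧ p)) ⟩
  mkℚᵘ (↧ p) 0 ℚᵘ.* ℚ.toℚᵘ p            ≈⟨ ℚᵘ.*≡* (solve (↧ p) (↥ p)) ⟩
  mkℚᵘ (↥ p) 0                          ≈⟨ toℚᵘ-toℚ (↥ p) ⟨
  ℚ.toℚᵘ (toℚ (↥ p))                  ∎)
  where
  open ℚᵘ.≃-Reasoning
  solve : ∀ a b → (a ℤ.* b) ℤ.* + 1 ≡ b ℤ.* (+ 1 ℤ.* a)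
  solve = ℤ-Solver.solve-∀

0≤p⇒0≤↥p : ∀ {p} → 0ℚ ℚ.≤ p → + 0 ℤ.≤ ↥ p
0≤p⇒0≤↥p {p@record{}} (*≤* le) = subst (+ 0 ℤ.≤_) (ℤ.*-identityʳ (↥ p)) le

recip : ∀ n .{{_ : NonZero n}} → Σ[ r ∈ ℚ ] (0ℚ ℚ.< r × fromℕ n ℚ.* r ≡ 1ℚ)
recip n = ℚ.1/ fromℕ n ,
          ℚ.positive⁻¹ _ {{ℚ.1/pos⇒pos (fromℕ n)}} , ℚ.*-inverseʳ (fromℕ n)
  where instance
    pos = fromℕ-positive n
    nz = ℚ.pos⇒nonZero (fromℕ n)

integerPart : ∀ p → Σ[ z ∈ ℤ ] (toℚ z ℚ.≤ p × p ℚ.< toℚ z ℚ.+ 1ℚ)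
integerPart p = z , below , above
  where
  D = ↧ₙ p
  n = ↥ p
  z = n ℤ./ℕ D
  r = n ℤ.%ℕ D
  instance pos = fromℕ-positive D
  n≡ : n ≡ + r ℤ.+ z ℤ.* + D
  n≡ = ℤ.a≡a%ℕn+[a/ℕn]*n n D
  below : toℚ z ℚ.≤ p
  below = ℚ.*-cancelˡ-≤-pos (fromℕ D) (begin
    fromℕ D ℚ.* toℚ z  ≡⟨ toℚ-* (+ D) z ⟨
    toℚ (+ D ℤ.* z)    ≤⟨ toℚ-mono-≤ (subst (+ D ℤ.* z ℤ.≤_) (trans (cong (ℤ._+_ (+ r)) (ℤ.*-comm (+ D) z)) (sym n≡)) (ℤ.i≤j+i _ (+ r))) ⟩
    toℚ n              ≡⟨ ↧*p≡↥ p ⟨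
    fromℕ D ℚ.* p        ∎)
    where open ℚ.≤-Reasoning
  above : p ℚ.< toℚ z ℚ.+ 1ℚ
  above = ℚ.*-cancelˡ-<-nonNeg (fromℕ D) {{ℚ.pos⇒nonNeg (fromℕ D)}} (begin-strict
    fromℕ D ℚ.* p                 ≡⟨ ↧*p≡↥ p ⟩
    toℚ n                       <⟨ toℚ-mono-< (subst₂ ℤ._<_ (sym n≡) (lem (+ D) z) (ℤ.+-monoˡ-< (z ℤ.* + D) (+<+ (ℤ.n%ℕd<d n D)))) ⟩
    toℚ (+ D ℤ.* (z ℤ.+ + 1))   ≡⟨ toℚ-* (+ D) (z ℤ.+ + 1) ⟩
    fromℕ D ℚ.* toℚ (z ℤ.+ + 1) ≡⟨ cong (fromℕ D ℚ.*_) (toℚ-suc z) ⟩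
    fromℕ D ℚ.* (toℚ z ℚ.+ 1ℚ)  ∎)
    where
    open ℚ.≤-Reasoning
    lem : ∀ a b → a ℤ.+ b ℤ.* a ≡ a ℤ.* (b ℤ.+ + 1)
    lem = ℤ-Solver.solve-∀

naturalAbove : ∀ p → Σ[ n ∈ ℕ ] p ℚ.< fromℕ n
naturalAbove p = ℤ.∣ z ℤ.+ + 1 ∣ , ℚ.<-≤-trans p<z+1 (ℚ.≤-trans (ℚ.≤-reflexive (sym (toℚ-suc z))) (toℚ-mono-≤ (i≤∣i∣ (z ℤ.+ + 1))))
  where
  z = proj₁ (integerPart p)
  p<z+1 = proj₂ (proj₂ (integerPart p))
  i≤∣i∣ : ∀ i → i ℤ.≤ + ℤ.∣ i ∣
  i≤∣i∣ (+ n) = ℤ.≤-refl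
  i≤∣i∣ (ℤ.-[1+ n ]) = ℤ.-≤+

0≤a∧0≤b⇒0≤a*b : ∀ {a b} → 0ℚ ℚ.≤ a → 0ℚ ℚ.≤ b → 0ℚ ℚ.≤ a ℚ.* b
0≤a∧0≤b⇒0≤a*b {a} {b} 0≤a 0≤b = subst (ℚ._≤ a ℚ.* b) (ℚ.*-zeroʳ a) (ℚ.*-monoˡ-≤-nonNeg a {{ℚ.nonNegative 0≤a}} 0≤b)

*-mono-≤ : ∀ {a b c e} → 0ℚ ℚ.≤ a → 0ℚ ℚ.≤ c → a ℚ.≤ b → c ℚ.≤ e → a ℚ.* c ℚ.≤ b ℚ.* e
*-mono-≤ {a} {b} {c} {e} 0≤a 0≤c a≤b c≤e =
  ℚ.≤-trans (ℚ.*-monoˡ-≤-nonNeg a {{ℚ.nonNegative 0≤a}} c≤e)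
            (ℚ.*-monoʳ-≤-nonNeg e {{ℚ.nonNegative (ℚ.≤-trans 0≤c c≤e)}} a≤b)

-- A fixed error `C` cannot absorb `m (a - b)` for all m. Both limits below are taken this way: m is
-- tied to the dilation factor in one and is 1/ε in the other.
archimedean : ∀ {a b C} → (∀ m .{{_ : NonZero m}} → fromℕ m ℚ.* a ℚ.≤ fromℕ m ℚ.* b ℚ.+ C) → a ℚ.≤ b
archimedean {a} {b} {C} bound with a ℚ.≤? b
... | yes a≤b = a≤b
... | no a≰b = contradiction (ℚ.<-≤-trans C-bound (bound (suc n))) (ℚ.<-irrefl refl)
  where
  open ℚ.≤-Reasoning
  lem : ∀ m a b → m ℚ.* b ℚ.+ m ℚ.* (a ℚ.- b) ≡ m ℚ.* a
  lem = Solver.solve-∀ ℚ-ring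
  δ = a ℚ.- b
  0<δ : 0ℚ ℚ.< δ
  0<δ = subst (ℚ._< δ) (ℚ.+-inverseʳ b) (ℚ.+-monoˡ-< (ℚ.- b) (ℚ.≰⇒> a≰b))
  instance
    δ-pos = ℚ.positive 0<δ
    δ-nz = ℚ.pos⇒nonZero δ
  -- Beyond C/δ the gap m·δ exceeds `C`; passing to the successor makes m nonzero.
  n = proj₁ (naturalAbove (C ℚ.* ℚ.1/ δ))
  m = fromℕ (suc n)
  C<mδ : C ℚ.< m ℚ.* δ
  C<mδ = begin-strict
    C                        ≡⟨ ℚ.*-identityʳ C ⟨
    C ℚ.* 1ℚ                 ≡⟨ cong (C ℚ.*_) (ℚ.*-inverseˡ δ) ⟨
    C ℚ.* (ℚ.1/ δ ℚ.* δ)     ≡⟨ ℚ.*-assoc C _ δ ⟨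
    C ℚ.* ℚ.1/ δ ℚ.* δ       <⟨ ℚ.*-monoˡ-<-pos δ (proj₂ (naturalAbove (C ℚ.* ℚ.1/ δ))) ⟩
    fromℕ n ℚ.* δ            ≤⟨ ℚ.*-monoʳ-≤-nonNeg δ {{ℚ.pos⇒nonNeg δ}} (fromℕ-mono-≤ (ℕ.n≤1+n n)) ⟩
    m ℚ.* δ                  ∎
  C-bound : m ℚ.* b ℚ.+ C ℚ.< m ℚ.* a
  C-bound = begin-strict
    m ℚ.* b ℚ.+ C            <⟨ ℚ.+-monoʳ-< (m ℚ.* b) C<mδ ⟩
    m ℚ.* b ℚ.+ m ℚ.* δ      ≡⟨ lem m a b ⟩
    m ℚ.* a                  ∎

i<j+1⇒i≤j : ∀ {i j} → i ℤ.< j ℤ.+ + 1 → i ℤ.≤ j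
i<j+1⇒i≤j {i} {j} i<j+1 = subst (i ℤ.≤_) (lem j) (ℤ.i<j⇒i≤pred[j] i<j+1)
  where
  lem : ∀ j → ℤ.- + 1 ℤ.+ (j ℤ.+ + 1) ≡ j
  lem = ℤ-Solver.solve-∀

-- Counting lattice points in simplices and boxes

private variable
  d : ℕ
  X : Set

-- Pigeonhole on positions in `E`. Repetitions in `E` do no harm, so the enumerations of overlapping
-- boxes may simply be concatenated.
n*k≤length : ∀ {N L} (g : Fin N → Fin L → X) →
  (∀ {i i′ j j′} → g i j ≡ g i′ j′ → i ≡ i′ × j ≡ j′) →
  (E : List X) → (∀ i j → g i j ∈ E) → N ℕ.* L ℕ.≤ length E
n*k≤length {N = N} {L} g inj E g∈E = Fin.injective⇒≤ {f = f} f-inj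
  where
  split : Fin (N ℕ.* L) → Fin N × Fin L
  split = Fin.remQuot L
  f : Fin (N ℕ.* L) → Fin (length E)
  f k = Any.index (g∈E (proj₁ (split k)) (proj₂ (split k)))
  f-inj : ∀ {k k′} → f k ≡ f k′ → k ≡ k′
  f-inj {k} {k′} eq = begin
    k                                                     ≡⟨ Fin.combine-remQuot {N} L k ⟨
    Fin.combine (proj₁ (split k)) (proj₂ (split k))       ≡⟨ cong₂ Fin.combine (proj₁ same) (proj₂ same) ⟩
    Fin.combine (proj₁ (split k′)) (proj₂ (split k′))     ≡⟨ Fin.combine-remQuot {N} L k′ ⟩
    k′                                                    ∎
    where
    open ≡-Reasoning
    same = inj (trans (Any.lookup-index (g∈E _ _)) (trans (cong (List.lookup E) eq) (sym (Any.lookup-index (g∈E _ _)))))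

addHead : ℕ → Vec ℕ (suc d) → Vec ℕ (suc d)
addHead r (a ∷ c) = r ℕ.+ a ∷ c

addHead-injective : ∀ r {b c : Vec ℕ (suc d)} → addHead r b ≡ addHead r c → b ≡ c
addHead-injective r {a ∷ _} {b ∷ _} eq =
  cong₂ _∷_ (ℕ.+-cancelˡ-≡ r a b (Vec.∷-injectiveˡ eq)) (Vec.∷-injectiveʳ eq)

-- Splitting by whether the head is positive is Pascal's rule; the length is the binomial
-- coefficient of m + d over d, the number of lattice points in the m-th dilate of the standard
-- d-simplex.
compositions : ∀ d → ℕ → List (Vec ℕ (suc d))
compositions zero    m       = (m ∷ []) ∷ []
compositions (suc d) zero    = Vec.replicate _ 0 ∷ []
compositions (suc d) (suc m) =
  List.map (addHead 1) (compositions (suc d) m) ++ List.map (0 ∷_) (compositions d (suc m))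

compositions-unique : ∀ d m → Unique (compositions d m)
compositions-unique zero    m       = [] ∷ []
compositions-unique (suc d) zero    = [] ∷ []
compositions-unique (suc d) (suc m) = Unique.++⁺
  (Unique.map⁺ (addHead-injective 1) (compositions-unique (suc d) m))
  (Unique.map⁺ Vec.∷-injectiveʳ (compositions-unique d (suc m)))
  λ (p , q) → disjoint (∈-map⁻ (addHead 1) p) (∈-map⁻ (0 ∷_) q)
  where
  disjoint : ∀ {c : Vec ℕ (suc (suc d))} {P : Vec ℕ (suc (suc d)) → Set} {Q : Vec ℕ (suc d) → Set} →
             (∃[ x ] (P x × c ≡ addHead 1 x)) → ¬ (∃[ x ] (Q x × c ≡ 0 ∷ x))
  disjoint (_ ∷ _ , _ , refl) (_ , _ , ())

sum-addHead : ∀ r (c : Vec ℕ (suc d)) → Vec.sum (addHead r c) ≡ r ℕ.+ Vec.sum c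
sum-addHead r (a ∷ c) = ℕ.+-assoc r a (Vec.sum c)

sum-replicate-0 : ∀ n → Vec.sum (Vec.replicate n 0) ≡ 0
sum-replicate-0 zero    = refl
sum-replicate-0 (suc n) = sum-replicate-0 n

compositions-sum : ∀ d m → All (λ c → Vec.sum c ≡ m) (compositions d m)
compositions-sum zero    m       = ℕ.+-identityʳ m ∷ []
compositions-sum (suc d) zero    = sum-replicate-0 (suc (suc d)) ∷ []
compositions-sum (suc d) (suc m) = All.++⁺
  (All.map⁺ (All.map (λ {c} eq → trans (sum-addHead 1 c) (cong suc eq)) (compositions-sum (suc d) m)))
  (All.map⁺ (compositions-sum d (suc m)))

-- Bounds the increment of the power d + 1 by its derivative at the right end, the growth that
-- Pascal's rule supplies in the next induction on m.
bernoulli : ∀ d m → suc m ℕ.^ suc d ℕ.≤ m ℕ.^ suc d ℕ.+ suc d ℕ.* suc m ℕ.^ d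
bernoulli zero    m = ℕ.≤-reflexive (lem m)
  where
  lem : ∀ m → suc m ℕ.* 1 ≡ m ℕ.* 1 ℕ.+ 1
  lem = ℕ-Solver.solve-∀
bernoulli (suc d) m = begin
  suc m ℕ.* p                                            ≡⟨⟩
  p ℕ.+ m ℕ.* p                                          ≤⟨ ℕ.+-monoʳ-≤ p (ℕ.*-monoʳ-≤ m (bernoulli d m)) ⟩
  p ℕ.+ m ℕ.* (m ℕ.^ suc d ℕ.+ suc d ℕ.* q)              ≤⟨ ℕ.m≤m+n _ (suc d ℕ.* q) ⟩
  p ℕ.+ m ℕ.* (m ℕ.^ suc d ℕ.+ suc d ℕ.* q) ℕ.+ suc d ℕ.* q  ≡⟨ lem m d q (m ℕ.^ suc d) ⟩
  m ℕ.* m ℕ.^ suc d ℕ.+ suc (suc d) ℕ.* p                ∎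
  where
  open ℕ.≤-Reasoning
  p = suc m ℕ.^ suc d
  q = suc m ℕ.^ d
  lem : ∀ m d q r → suc m ℕ.* q ℕ.+ m ℕ.* (r ℕ.+ suc d ℕ.* q) ℕ.+ suc d ℕ.* q ≡ m ℕ.* r ℕ.+ suc (suc d) ℕ.* (suc m ℕ.* q)
  lem = ℕ-Solver.solve-∀

-- Only the leading coefficient 1/d! of the binomial matters. By Pascal's rule the right side grows
-- by (d+1)·d! times the count one dimension lower, which dominates the increment bounded in
-- `bernoulli`.
m^d≤d!*compositions : ∀ d m → m ℕ.^ d ℕ.≤ d ! ℕ.* length (compositions d m)
m^d≤d!*compositions zero    m       = ℕ.≤-refl
m^d≤d!*compositions (suc d) zero    = z≤n
m^d≤d!*compositions (suc d) (suc m) = begin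
  suc m ℕ.^ suc d                                             ≤⟨ bernoulli d m ⟩
  m ℕ.^ suc d ℕ.+ suc d ℕ.* suc m ℕ.^ d                       ≤⟨ ℕ.+-mono-≤ (m^d≤d!*compositions (suc d) m) (ℕ.*-monoʳ-≤ (suc d) (m^d≤d!*compositions d (suc m))) ⟩
  suc d ! ℕ.* a ℕ.+ suc d ℕ.* (d ! ℕ.* b)                     ≡⟨ lem (suc d) (d !) a b ⟩
  suc d ! ℕ.* (a ℕ.+ b)                                       ≡⟨ cong (suc d ! ℕ.*_) (cong₂ ℕ._+_ (List.length-map (addHead 1) (compositions (suc d) m)) (List.length-map (0 ∷_) (compositions d (suc m)))) ⟨
  suc d ! ℕ.* (length xs ℕ.+ length ys)                       ≡⟨ cong (suc d ! ℕ.*_) (List.length-++ xs) ⟨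
  suc d ! ℕ.* length (compositions (suc d) (suc m))           ∎
  where
  open ℕ.≤-Reasoning
  a = length (compositions (suc d) m)
  b = length (compositions d (suc m))
  xs = List.map (addHead 1) (compositions (suc d) m)
  ys = List.map (0 ∷_) (compositions d (suc m))
  lem : ∀ e f a b → e ℕ.* f ℕ.* a ℕ.+ e ℕ.* (f ℕ.* b) ≡ e ℕ.* f ℕ.* (a ℕ.+ b)
  lem = ℕ-Solver.solve-∀

-- Lattice points in dilated boxes

2ℚ : ℚ
2ℚ = 1ℚ ℚ.+ 1ℚ

-- The list starts at the floor `lo` of `a`. Since a < lo + 1, an integer y ≤ b has y - lo < b - a +
-- 1, so the floor of that number plus one entries suffice; hence the slack of 2.
integersBetween : ∀ {a b} → a ℚ.≤ b → Σ[ E ∈ List ℤ ]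
  ((∀ y → a ℚ.≤ toℚ y → toℚ y ℚ.≤ b → y ∈ E) × fromℕ (length E) ℚ.≤ b ℚ.- a ℚ.+ 2ℚ)
integersBetween {a} {b} a≤b = E , complete , short
  where
  open ℚ.≤-Reasoning
  lo = proj₁ (integerPart a)
  lo≤a = proj₁ (proj₂ (integerPart a))
  a<lo+1 = proj₂ (proj₂ (integerPart a))
  w = b ℚ.- a ℚ.+ 1ℚ
  z = proj₁ (integerPart w)
  z≤w = proj₁ (proj₂ (integerPart w))
  w<z+1 = proj₂ (proj₂ (integerPart w))
  len = suc ℤ.∣ z ∣
  E = List.map (λ k → + k ℤ.+ lo) (List.upTo len)
  bound : ∀ y → toℚ y ℚ.≤ b → y ℤ.- lo ℤ.< z ℤ.+ + 1
  bound y y≤b = toℚ-cancel-< (begin-strict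
    toℚ (y ℤ.- lo)                         ≡⟨ lem₁ (toℚ (y ℤ.- lo)) (toℚ lo) ⟩
    toℚ (y ℤ.- lo) ℚ.+ toℚ lo ℚ.- toℚ lo ≡⟨ cong (ℚ._- toℚ lo) (toℚ-+ (y ℤ.- lo) lo) ⟨
    toℚ (y ℤ.- lo ℤ.+ lo) ℚ.- toℚ lo     ≡⟨ cong (λ x → toℚ x ℚ.- toℚ lo) (lem₂ y lo) ⟩
    toℚ y ℚ.- toℚ lo                     ≤⟨ ℚ.+-monoˡ-≤ (ℚ.- toℚ lo) y≤b ⟩
    b ℚ.- toℚ lo                           ≡⟨ lem₃ b (toℚ lo) ⟩
    b ℚ.- (toℚ lo ℚ.+ 1ℚ) ℚ.+ 1ℚ           <⟨ ℚ.+-monoˡ-< 1ℚ (ℚ.+-monoʳ-< b (ℚ.neg-antimono-< a<lo+1)) ⟩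
    b ℚ.- a ℚ.+ 1ℚ                           <⟨ w<z+1 ⟩
    toℚ z ℚ.+ 1ℚ                           ≡⟨ toℚ-suc z ⟨
    toℚ (z ℤ.+ + 1)                        ∎)
    where
    lem₁ : ∀ x l → x ≡ x ℚ.+ l ℚ.- l
    lem₁ = Solver.solve-∀ ℚ-ring
    lem₂ : ∀ y l → y ℤ.- l ℤ.+ l ≡ y
    lem₂ = ℤ-Solver.solve-∀
    lem₃ : ∀ b l → b ℚ.- l ≡ b ℚ.- (l ℚ.+ 1ℚ) ℚ.+ 1ℚ
    lem₃ = Solver.solve-∀ ℚ-ring
  0<z+1 : + 0 ℤ.< z ℤ.+ + 1
  0<z+1 = subst (ℤ._< z ℤ.+ + 1) (ℤ.+-inverseʳ lo) (bound lo (ℚ.≤-trans lo≤a a≤b))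
  0≤z : + 0 ℤ.≤ z
  0≤z = i<j+1⇒i≤j 0<z+1
  ∣z∣ : + ℤ.∣ z ∣ ≡ z
  ∣z∣ = ℤ.0≤i⇒+∣i∣≡i 0≤z
  complete : ∀ y → a ℚ.≤ toℚ y → toℚ y ℚ.≤ b → y ∈ E
  complete y a≤y y≤b = subst (_∈ E) k+lo (∈-map⁺ (λ k → + k ℤ.+ lo) (∈-upTo⁺ k<len))
    where
    k = ℤ.∣ y ℤ.- lo ∣
    +k : + k ≡ y ℤ.- lo
    +k = ℤ.0≤i⇒+∣i∣≡i (ℤ.i≤j⇒0≤j-i {lo} {y} (toℚ-cancel-≤ {lo} {y} (ℚ.≤-trans lo≤a a≤y)))
    k<len : k ℕ.< len
    k<len = ℤ.drop‿+<+ (subst₂ ℤ._<_ (sym +k) (trans (ℤ.+-comm z (+ 1)) (cong (ℤ._+_ (+ 1)) (sym ∣z∣))) (bound y y≤b))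
    k+lo : + k ℤ.+ lo ≡ y
    k+lo = trans (cong (ℤ._+ lo) +k) (lem y lo)
      where
      lem : ∀ y l → y ℤ.- l ℤ.+ l ≡ y
      lem = ℤ-Solver.solve-∀
  short : fromℕ (length E) ℚ.≤ b ℚ.- a ℚ.+ 2ℚ
  short = begin
    fromℕ (length E)               ≡⟨ cong fromℕ (trans (List.length-map (λ k → + k ℤ.+ lo) (List.upTo len)) (List.length-upTo len)) ⟩
    fromℕ len                      ≡⟨ trans (fromℕ-+ 1 ℤ.∣ z ∣) (cong (ℚ._+ fromℕ ℤ.∣ z ∣) (sym 1≡toℚ)) ⟩
    1ℚ ℚ.+ fromℕ ℤ.∣ z ∣           ≡⟨ cong (λ x → 1ℚ ℚ.+ toℚ x) ∣z∣ ⟩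
    1ℚ ℚ.+ toℚ z                 ≤⟨ ℚ.+-monoʳ-≤ 1ℚ z≤w ⟩
    1ℚ ℚ.+ (b ℚ.- a ℚ.+ 1ℚ)        ≡⟨ lem (b ℚ.- a) 1ℚ ⟩
    b ℚ.- a ℚ.+ 2ℚ                 ∎
    where
    lem : ∀ x i → i ℚ.+ (x ℚ.+ i) ≡ x ℚ.+ (i ℚ.+ i)
    lem = Solver.solve-∀ ℚ-ring

length-cartesianProductWith : ∀ {A B C : Set} (f : A → B → C) xs ys →
  length (List.cartesianProductWith f xs ys) ≡ length xs ℕ.* length ys
length-cartesianProductWith f []       ys = refl
length-cartesianProductWith f (x ∷ xs) ys =
  trans (List.length-++ (List.map (f x) ys))
        (cong₂ ℕ._+_ (List.length-map (f x) ys) (length-cartesianProductWith f xs ys))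

0≤b-a : ∀ {a b} → a ℚ.≤ b → 0ℚ ℚ.≤ b ℚ.- a
0≤b-a {a} {b} a≤b = subst (ℚ._≤ b ℚ.- a) (ℚ.+-inverseʳ a) (ℚ.+-monoˡ-≤ (ℚ.- a) a≤b)

latticePointsBetween : ∀ {d} (lo up : Fin d → ℚ) → (∀ j → lo j ℚ.≤ up j) → Σ[ E ∈ List (Vec ℤ d) ]
  ((∀ y → (∀ j → lo j ℚ.≤ toℚ (lookup y j) × toℚ (lookup y j) ℚ.≤ up j) → y ∈ E)
  × fromℕ (length E) ℚ.≤ Πℚ (λ j → up j ℚ.- lo j ℚ.+ 2ℚ))
latticePointsBetween {zero}  lo up lo≤up = ([] ∷ []) , (λ { [] _ → here refl }) , ℚ.≤-reflexive (sym 1≡toℚ)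
latticePointsBetween {suc d} lo up lo≤up =
  List.cartesianProductWith _∷_ E F
  , (λ { (y ∷ ys) bd → ∈-cartesianProductWith⁺ _∷_ (proj₁ (proj₂ I) y (proj₁ (bd zero)) (proj₂ (bd zero))) (proj₁ (proj₂ R) ys (bd ∘ suc)) })
  , short
  where
  I = integersBetween (lo≤up zero)
  R = latticePointsBetween (lo ∘ suc) (up ∘ suc) (lo≤up ∘ suc)
  E = proj₁ I
  F = proj₁ R
  short : fromℕ (length (List.cartesianProductWith _∷_ E F)) ℚ.≤ (up zero ℚ.- lo zero ℚ.+ 2ℚ) ℚ.* Πℚ (λ j → up (suc j) ℚ.- lo (suc j) ℚ.+ 2ℚ)
  short = ℚ.≤-trans (ℚ.≤-reflexive (trans (cong fromℕ (length-cartesianProductWith _∷_ E F)) (fromℕ-* (length E) (length F))))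
              (*-mono-≤ (0≤fromℕ (length E)) (0≤fromℕ (length F)) (proj₂ (proj₂ I)) (proj₂ (proj₂ R)))

InDilate : ℕ → Vec ℤ d → Box d → Set
InDilate m y B = ∀ j → fromℕ m ℚ.* lower B j ℚ.≤ toℚ (lookup y j)
                     × toℚ (lookup y j) ℚ.≤ fromℕ m ℚ.* upper B j

Σᴮ : List (Box d) → (Box d → ℚ) → ℚ
Σᴮ Bs f = List.foldr ℚ._+_ 0ℚ (List.map f Bs)

side : Box d → Fin d → ℚ
side B j = upper B j ℚ.- lower B j

0≤side : (B : Box d) → ∀ j → 0ℚ ℚ.≤ side B j
0≤side B j = 0≤b-a (lower≤upper B j)

Πℚ-cong : ∀ {n} {f g : Fin n → ℚ} → (∀ i → f i ≡ g i) → Πℚ f ≡ Πℚ g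
Πℚ-cong {zero}  eq = refl
Πℚ-cong {suc n} eq = cong₂ ℚ._*_ (eq zero) (Πℚ-cong (eq ∘ suc))

latticePointsInDilate : ∀ m (B : Box d) → Σ[ E ∈ List (Vec ℤ d) ]
  ((∀ y → InDilate m y B → y ∈ E) × fromℕ (length E) ℚ.≤ Πℚ (λ j → fromℕ m ℚ.* side B j ℚ.+ 2ℚ))
latticePointsInDilate m B =
  proj₁ P , proj₁ (proj₂ P)
  , ℚ.≤-trans (proj₂ (proj₂ P)) (ℚ.≤-reflexive (Πℚ-cong λ j → cong (ℚ._+ 2ℚ) (lem (fromℕ m) (lower B j) (upper B j))))
  where
  P = latticePointsBetween (λ j → fromℕ m ℚ.* lower B j) (λ j → fromℕ m ℚ.* upper B j)
        (λ j → ℚ.*-monoˡ-≤-nonNeg (fromℕ m) {{ℚ.nonNegative (0≤fromℕ m)}} (lower≤upper B j))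
  lem : ∀ m l u → m ℚ.* u ℚ.- m ℚ.* l ≡ m ℚ.* (u ℚ.- l)
  lem = Solver.solve-∀ ℚ-ring

latticePointsInDilates : ∀ m (Bs : List (Box d)) → Σ[ E ∈ List (Vec ℤ d) ]
  ((∀ y → Any (InDilate m y) Bs → y ∈ E)
  × fromℕ (length E) ℚ.≤ Σᴮ Bs (λ B → Πℚ (λ j → fromℕ m ℚ.* side B j ℚ.+ 2ℚ)))
latticePointsInDilates m [] = [] , (λ _ ()) , ℚ.≤-reflexive (sym 0≡toℚ)
latticePointsInDilates m (B ∷ Bs) =
  E ++ F
  , (λ { y (here p) → ∈-++⁺ˡ (proj₁ (proj₂ P) y p) ; y (there p) → ∈-++⁺ʳ E (proj₁ (proj₂ Q) y p) })
  , ℚ.≤-trans (ℚ.≤-reflexive (trans (cong fromℕ (List.length-++ E)) (fromℕ-+ (length E) (length F))))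
              (ℚ.+-mono-≤ (proj₂ (proj₂ P)) (proj₂ (proj₂ Q)))
  where
  P = latticePointsInDilate m B
  Q = latticePointsInDilates m Bs
  E = proj₁ P
  F = proj₁ Q

Πℚ-nonNeg : ∀ {n} {f : Fin n → ℚ} → (∀ i → 0ℚ ℚ.≤ f i) → 0ℚ ℚ.≤ Πℚ f
Πℚ-nonNeg {zero}  0≤f = ℚ.nonNegative⁻¹ 1ℚ
Πℚ-nonNeg {suc n} 0≤f = 0≤a∧0≤b⇒0≤a*b (0≤f zero) (Πℚ-nonNeg (0≤f ∘ suc))

0≤a+b : ∀ {a b} → 0ℚ ℚ.≤ a → 0ℚ ℚ.≤ b → 0ℚ ℚ.≤ a ℚ.+ b
0≤a+b 0≤a 0≤b = ℚ.+-mono-≤ 0≤a 0≤b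

-- An expansion at m = ∞, multiplied through by m so that no division occurs.
leadingTerm : ∀ {d} (l K : Fin d → ℚ) → (∀ j → 0ℚ ℚ.≤ l j) → (∀ j → 0ℚ ℚ.≤ K j) →
  Σ[ C ∈ ℚ ] (0ℚ ℚ.≤ C × (∀ m .{{_ : NonZero m}} →
    fromℕ m ℚ.* Πℚ (λ j → fromℕ m ℚ.* l j ℚ.+ K j) ℚ.≤ fromℕ (m ℕ.^ d) ℚ.* (fromℕ m ℚ.* Πℚ l ℚ.+ C)))
leadingTerm {zero} l K 0≤l 0≤K = 0ℚ , ℚ.≤-refl , λ m → ℚ.≤-reflexive (trans (lem (fromℕ m)) (cong (ℚ._* (fromℕ m ℚ.* 1ℚ ℚ.+ 0ℚ)) 1≡toℚ))
  where
  lem : ∀ m → m ℚ.* 1ℚ ≡ 1ℚ ℚ.* (m ℚ.* 1ℚ ℚ.+ 0ℚ)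
  lem = Solver.solve-∀ ℚ-ring
leadingTerm {suc d} l K 0≤l 0≤K =
  l₀ ℚ.* C ℚ.+ K₀ ℚ.* V ℚ.+ K₀ ℚ.* C
  , 0≤a+b (0≤a+b (0≤a∧0≤b⇒0≤a*b (0≤l zero) 0≤C) (0≤a∧0≤b⇒0≤a*b (0≤K zero) 0≤V)) 0≤K₀C
  , bound′
  where
  P = leadingTerm (l ∘ suc) (K ∘ suc) (0≤l ∘ suc) (0≤K ∘ suc)
  C = proj₁ P
  0≤C = proj₁ (proj₂ P)
  l₀ = l zero
  K₀ = K zero
  V = Πℚ (l ∘ suc)
  0≤V = Πℚ-nonNeg (0≤l ∘ suc)
  0≤K₀C = 0≤a∧0≤b⇒0≤a*b (0≤K zero) 0≤C
  bound′ : ∀ m .{{_ : NonZero m}} →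
    fromℕ m ℚ.* Πℚ (λ j → fromℕ m ℚ.* l j ℚ.+ K j)
      ℚ.≤ fromℕ (m ℕ.^ suc d) ℚ.* (fromℕ m ℚ.* (l₀ ℚ.* V) ℚ.+ (l₀ ℚ.* C ℚ.+ K₀ ℚ.* V ℚ.+ K₀ ℚ.* C))
  bound′ m = begin
    q ℚ.* ((q ℚ.* l₀ ℚ.+ K₀) ℚ.* R)                ≡⟨ lem₁ q (q ℚ.* l₀ ℚ.+ K₀) R ⟩
    (q ℚ.* l₀ ℚ.+ K₀) ℚ.* (q ℚ.* R)                ≤⟨ ℚ.*-monoˡ-≤-nonNeg (q ℚ.* l₀ ℚ.+ K₀) {{ℚ.nonNegative (0≤a+b (0≤a∧0≤b⇒0≤a*b (0≤fromℕ m) (0≤l zero)) (0≤K zero))}} (proj₂ (proj₂ P) m) ⟩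
    (q ℚ.* l₀ ℚ.+ K₀) ℚ.* (r ℚ.* (q ℚ.* V ℚ.+ C))  ≡⟨ lem₂ q r l₀ K₀ V C ⟩
    r ℚ.* (q ℚ.* (q ℚ.* (l₀ ℚ.* V) ℚ.+ (l₀ ℚ.* C ℚ.+ K₀ ℚ.* V)) ℚ.+ K₀ ℚ.* C)
      ≤⟨ ℚ.*-monoˡ-≤-nonNeg r {{ℚ.nonNegative (0≤fromℕ (m ℕ.^ d))}} (ℚ.+-monoʳ-≤ (q ℚ.* (q ℚ.* (l₀ ℚ.* V) ℚ.+ (l₀ ℚ.* C ℚ.+ K₀ ℚ.* V))) K₀C≤) ⟩
    r ℚ.* (q ℚ.* (q ℚ.* (l₀ ℚ.* V) ℚ.+ (l₀ ℚ.* C ℚ.+ K₀ ℚ.* V)) ℚ.+ q ℚ.* (K₀ ℚ.* C))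
      ≡⟨ lem₃ q r (q ℚ.* (l₀ ℚ.* V)) (l₀ ℚ.* C ℚ.+ K₀ ℚ.* V) (K₀ ℚ.* C) ⟩
    q ℚ.* r ℚ.* (q ℚ.* (l₀ ℚ.* V) ℚ.+ (l₀ ℚ.* C ℚ.+ K₀ ℚ.* V ℚ.+ K₀ ℚ.* C))
      ≡⟨ cong (ℚ._* (q ℚ.* (l₀ ℚ.* V) ℚ.+ (l₀ ℚ.* C ℚ.+ K₀ ℚ.* V ℚ.+ K₀ ℚ.* C))) (fromℕ-* m (m ℕ.^ d)) ⟨
    fromℕ (m ℕ.^ suc d) ℚ.* (q ℚ.* (l₀ ℚ.* V) ℚ.+ (l₀ ℚ.* C ℚ.+ K₀ ℚ.* V ℚ.+ K₀ ℚ.* C)) ∎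
    where
    open ℚ.≤-Reasoning
    q = fromℕ m
    r = fromℕ (m ℕ.^ d)
    R = Πℚ (λ j → q ℚ.* l (suc j) ℚ.+ K (suc j))
    -- The term of lowest degree in m is absorbed into the constant because m ≥ 1.
    K₀C≤ : K₀ ℚ.* C ℚ.≤ q ℚ.* (K₀ ℚ.* C)
    K₀C≤ = ℚ.≤-trans (ℚ.≤-reflexive (sym (ℚ.*-identityˡ (K₀ ℚ.* C))))
                     (ℚ.*-monoʳ-≤-nonNeg (K₀ ℚ.* C) {{ℚ.nonNegative 0≤K₀C}} (subst (ℚ._≤ q) (sym 1≡toℚ) (fromℕ-mono-≤ {1} {m} (ℕ.>-nonZero⁻¹ m))))
    lem₁ : ∀ q x P → q ℚ.* (x ℚ.* P) ≡ x ℚ.* (q ℚ.* P)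
    lem₁ = Solver.solve-∀ ℚ-ring
    lem₂ : ∀ q r l K V C → (q ℚ.* l ℚ.+ K) ℚ.* (r ℚ.* (q ℚ.* V ℚ.+ C)) ≡
      r ℚ.* (q ℚ.* (q ℚ.* (l ℚ.* V) ℚ.+ (l ℚ.* C ℚ.+ K ℚ.* V)) ℚ.+ K ℚ.* C)
    lem₂ = Solver.solve-∀ ℚ-ring
    lem₃ : ∀ q r a b c → r ℚ.* (q ℚ.* (a ℚ.+ b) ℚ.+ q ℚ.* c) ≡ q ℚ.* r ℚ.* (a ℚ.+ (b ℚ.+ c))
    lem₃ = Solver.solve-∀ ℚ-ring

-- The boxes are dilated by m + n but measured against powers of m: the fixed part n·side of each
-- factor is moved into the constant term, which does not affect the leading coefficient.
leadingTermᴮ : ∀ n (Bs : List (Box d)) → Σ[ C ∈ ℚ ] (∀ m .{{_ : NonZero m}} →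
  fromℕ m ℚ.* Σᴮ Bs (λ B → Πℚ (λ j → fromℕ (m ℕ.+ n) ℚ.* side B j ℚ.+ 2ℚ))
    ℚ.≤ fromℕ (m ℕ.^ d) ℚ.* (fromℕ m ℚ.* totalVolume Bs ℚ.+ C))
leadingTermᴮ {d} n [] = 0ℚ , λ m → ℚ.≤-reflexive (lem (fromℕ m) (fromℕ (m ℕ.^ d)))
  where
  lem : ∀ m r → m ℚ.* 0ℚ ≡ r ℚ.* (m ℚ.* 0ℚ ℚ.+ 0ℚ)
  lem = Solver.solve-∀ ℚ-ring
leadingTermᴮ {d} n (B ∷ Bs) = C ℚ.+ C′ , λ m → begin
    fromℕ m ℚ.* (Πℚ (λ j → fromℕ (m ℕ.+ n) ℚ.* side B j ℚ.+ 2ℚ) ℚ.+ rest m)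
      ≡⟨ ℚ.*-distribˡ-+ (fromℕ m) _ (rest m) ⟩
    fromℕ m ℚ.* Πℚ (λ j → fromℕ (m ℕ.+ n) ℚ.* side B j ℚ.+ 2ℚ) ℚ.+ fromℕ m ℚ.* rest m
      ≡⟨ cong (λ x → fromℕ m ℚ.* x ℚ.+ fromℕ m ℚ.* rest m) (Πℚ-cong λ j → trans (cong (λ x → x ℚ.* side B j ℚ.+ 2ℚ) (fromℕ-+ m n)) (lem₁ (fromℕ m) (fromℕ n) (side B j) 2ℚ)) ⟩
    fromℕ m ℚ.* Πℚ (λ j → fromℕ m ℚ.* side B j ℚ.+ (fromℕ n ℚ.* side B j ℚ.+ 2ℚ)) ℚ.+ fromℕ m ℚ.* rest m
      ≤⟨ ℚ.+-mono-≤ (proj₂ (proj₂ P) m) (proj₂ P′ m) ⟩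
    fromℕ (m ℕ.^ d) ℚ.* (fromℕ m ℚ.* boxVolume B ℚ.+ C) ℚ.+ fromℕ (m ℕ.^ d) ℚ.* (fromℕ m ℚ.* totalVolume Bs ℚ.+ C′)
      ≡⟨ lem₂ (fromℕ (m ℕ.^ d)) (fromℕ m) (boxVolume B) C (totalVolume Bs) C′ ⟩
    fromℕ (m ℕ.^ d) ℚ.* (fromℕ m ℚ.* (boxVolume B ℚ.+ totalVolume Bs) ℚ.+ (C ℚ.+ C′)) ∎
  where
  P = leadingTerm (side B) (λ j → fromℕ n ℚ.* side B j ℚ.+ 2ℚ) (0≤side B)
        (λ j → 0≤a+b (0≤a∧0≤b⇒0≤a*b (0≤fromℕ n) (0≤side B j)) (ℚ.nonNegative⁻¹ 2ℚ))
  P′ = leadingTermᴮ n Bs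
  C = proj₁ P
  C′ = proj₁ P′
  open ℚ.≤-Reasoning
  rest : ℕ → ℚ
  rest m = Σᴮ Bs (λ B → Πℚ (λ j → fromℕ (m ℕ.+ n) ℚ.* side B j ℚ.+ 2ℚ))
  lem₁ : ∀ m n s t → (m ℚ.+ n) ℚ.* s ℚ.+ t ≡ m ℚ.* s ℚ.+ (n ℚ.* s ℚ.+ t)
  lem₁ = Solver.solve-∀ ℚ-ring
  lem₂ : ∀ r m b c t c′ → r ℚ.* (m ℚ.* b ℚ.+ c) ℚ.+ r ℚ.* (m ℚ.* t ℚ.+ c′) ≡ r ℚ.* (m ℚ.* (b ℚ.+ t) ℚ.+ (c ℚ.+ c′))
  lem₂ = Solver.solve-∀ ℚ-ring

-- The N families hold at least N·mᵈ/d! distinct points, while the boxes dilated by m + n contain at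
-- most mᵈ (totalVolume + C/m) lattice points. Cancelling mᵈ and letting m grow leaves the claim;
-- the constant shift n disappears in the limit.
latticeCount⇒volume≥ : ∀ {d} (Bs : List (Box d)) N n →
  (g : ∀ m → Fin N → Fin (length (compositions d m)) → Vec ℤ d) →
  (∀ m {i i′ j j′} → g m i j ≡ g m i′ j′ → i ≡ i′ × j ≡ j′) →
  (∀ m .{{_ : NonZero m}} i j → Any (InDilate (m ℕ.+ n) (g m i j)) Bs) →
  fromℕ N ℚ.≤ fromℕ (d !) ℚ.* totalVolume Bs
latticeCount⇒volume≥ {d} Bs N n g g-inj g∈Bs = archimedean {C = f ℚ.* C} bound
  where
  open ℚ.≤-Reasoning
  f = fromℕ (d !)
  C = proj₁ (leadingTermᴮ n Bs)
  bound : ∀ m .{{_ : NonZero m}} → fromℕ m ℚ.* fromℕ N ℚ.≤ fromℕ m ℚ.* (f ℚ.* totalVolume Bs) ℚ.+ f ℚ.* C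
  bound m = ℚ.*-cancelˡ-≤-pos r {{fromℕ-positive (m ℕ.^ d) {{ℕ.m^n≢0 m d}}}} (begin
    r ℚ.* (q ℚ.* fromℕ N)                  ≡⟨ lem₁ r q (fromℕ N) ⟩
    q ℚ.* (fromℕ N ℚ.* r)                  ≤⟨ q*-mono (begin
      fromℕ N ℚ.* r                          ≡⟨ fromℕ-* N (m ℕ.^ d) ⟨
      fromℕ (N ℕ.* m ℕ.^ d)                  ≤⟨ fromℕ-mono-≤ count ⟩
      fromℕ (d ! ℕ.* length E)               ≡⟨ fromℕ-* (d !) (length E) ⟩
      f ℚ.* fromℕ (length E)                 ≤⟨ f*-mono E-short ⟩
      f ℚ.* S                                ∎) ⟩
    q ℚ.* (f ℚ.* S)                        ≡⟨ lem₂ q f S ⟩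
    f ℚ.* (q ℚ.* S)                        ≤⟨ f*-mono (proj₂ (leadingTermᴮ n Bs) m) ⟩
    f ℚ.* (r ℚ.* (q ℚ.* totalVolume Bs ℚ.+ C))  ≡⟨ lem₃ f r q (totalVolume Bs) C ⟩
    r ℚ.* (q ℚ.* (f ℚ.* totalVolume Bs) ℚ.+ f ℚ.* C) ∎)
    where
    q = fromℕ m
    r = fromℕ (m ℕ.^ d)
    L = length (compositions d m)
    E = proj₁ (latticePointsInDilates (m ℕ.+ n) Bs)
    E-complete = proj₁ (proj₂ (latticePointsInDilates (m ℕ.+ n) Bs))
    E-short = proj₂ (proj₂ (latticePointsInDilates (m ℕ.+ n) Bs))
    S = Σᴮ Bs (λ B → Πℚ (λ j → fromℕ (m ℕ.+ n) ℚ.* side B j ℚ.+ 2ℚ))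
    q*-mono : ∀ {a b} → a ℚ.≤ b → q ℚ.* a ℚ.≤ q ℚ.* b
    q*-mono = ℚ.*-monoˡ-≤-nonNeg q {{ℚ.nonNegative (0≤fromℕ m)}}
    f*-mono : ∀ {a b} → a ℚ.≤ b → f ℚ.* a ℚ.≤ f ℚ.* b
    f*-mono = ℚ.*-monoˡ-≤-nonNeg f {{ℚ.nonNegative (0≤fromℕ (d !))}}
    lem₁ : ∀ r q N → r ℚ.* (q ℚ.* N) ≡ q ℚ.* (N ℚ.* r)
    lem₁ = Solver.solve-∀ ℚ-ring
    lem₂ : ∀ q f S → q ℚ.* (f ℚ.* S) ≡ f ℚ.* (q ℚ.* S)
    lem₂ = Solver.solve-∀ ℚ-ring
    lem₃ : ∀ f r q T C → f ℚ.* (r ℚ.* (q ℚ.* T ℚ.+ C)) ≡ r ℚ.* (q ℚ.* (f ℚ.* T) ℚ.+ f ℚ.* C)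
    lem₃ = Solver.solve-∀ ℚ-ring
    count : N ℕ.* m ℕ.^ d ℕ.≤ d ! ℕ.* length E
    count = ℕ.≤-trans (ℕ.*-monoʳ-≤ N (m^d≤d!*compositions d m))
      (ℕ.≤-trans (ℕ.≤-reflexive (comm N (d !) L))
        (ℕ.*-monoʳ-≤ (d !) (n*k≤length (g m) (g-inj m) E λ i j → E-complete (g m i j) (g∈Bs m i j))))
      where
      comm : ∀ N f L → N ℕ.* (f ℕ.* L) ≡ f ℕ.* (N ℕ.* L)
      comm = ℕ-Solver.solve-∀

-- Integral combinations of homogenised points

lookup-unique-injective : ∀ {X : Set} {xs : List X} → Unique xs → ∀ {i j} →
  List.lookup xs i ≡ List.lookup xs j → i ≡ j
lookup-unique-injective (_ ∷ _)  {zero}  {zero}  _  = refl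
lookup-unique-injective (p ∷ _)  {zero}  {suc j} eq = ⊥-elim (All.lookup p (∈-lookup j) eq)
lookup-unique-injective (p ∷ _)  {suc i} {zero}  eq = ⊥-elim (All.lookup p (∈-lookup i) (sym eq))
lookup-unique-injective (_ ∷ ps) {suc i} {suc j} eq = cong suc (lookup-unique-injective ps eq)

lookup-ext : ∀ {X : Set} {n} {x y : Vec X n} → (∀ j → lookup x j ≡ lookup y j) → x ≡ y
lookup-ext {x = x} {y} eq =
  trans (sym (Vec.tabulate∘lookup x)) (trans (Vec.tabulate-cong eq) (Vec.tabulate∘lookup y))

single : ∀ {n} → Fin n → ℤ → Fin n → ℤ
single zero    r zero    = r
single zero    r (suc _) = ℤ.0ℤ
single (suc i) r zero    = ℤ.0ℤ
single (suc i) r (suc j) = single i r j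

single-same : ∀ {n} (i : Fin n) r → single i r i ≡ r
single-same zero    r = refl
single-same (suc i) r = single-same i r

single-other : ∀ {n} (i j : Fin n) r → j ≢ i → single i r j ≡ ℤ.0ℤ
single-other zero    zero    r j≢i = contradiction refl j≢i
single-other zero    (suc j) r j≢i = refl
single-other (suc i) zero    r j≢i = refl
single-other (suc i) (suc j) r j≢i = single-other i j r (j≢i ∘ cong suc)

0≤single : ∀ {n} (i : Fin n) {r} → ℤ.0ℤ ℤ.≤ r → ∀ j → ℤ.0ℤ ℤ.≤ single i r j
0≤single zero    0≤r zero    = 0≤r
0≤single zero    0≤r (suc j) = ℤ.≤-refl
0≤single (suc i) 0≤r zero    = ℤ.≤-refl
0≤single (suc i) 0≤r (suc j) = 0≤single i 0≤r j

M∣single : ∀ {n M} (i : Fin n) j → M ∣ single i M j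
M∣single {M = M} zero    zero    = divides (+ 1) (sym (ℤ.*-identityˡ M))
M∣single         zero    (suc j) = divides ℤ.0ℤ refl
M∣single         (suc i) zero    = divides ℤ.0ℤ refl
M∣single         (suc i) (suc j) = M∣single i j

sum-single-* : ∀ {n} (i : Fin n) r (f : Fin n → ℤ) → Σℤ.sum (λ j → single i r j ℤ.* f j) ≡ r ℤ.* f i
sum-single-* {suc n} zero    r f = trans
  (cong (ℤ._+_ (r ℤ.* f zero)) (Σℤ.sum-replicate-zero n)) (ℤ.+-identityʳ (r ℤ.* f zero))
sum-single-* {suc n} (suc i) r f = trans (ℤ.+-identityˡ _) (sum-single-* i r (f ∘ suc))

∣-difference : ∀ m x y f g → x ℤ.+ m ℤ.* f ≡ y ℤ.+ m ℤ.* g → m ∣ y ℤ.- x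
∣-difference m x y f g eq = divides (f ℤ.- g)
  (trans (lem₁ m x y g) (trans (cong (λ z → z ℤ.- m ℤ.* g ℤ.- x) (sym eq)) (lem₂ m x f g)))
  where
  lem₁ : ∀ m x y g → y ℤ.- x ≡ (y ℤ.+ m ℤ.* g) ℤ.- m ℤ.* g ℤ.- x
  lem₁ = ℤ-Solver.solve-∀
  lem₂ : ∀ m x f g → (x ℤ.+ m ℤ.* f) ℤ.- m ℤ.* g ℤ.- x ≡ (f ℤ.- g) ℤ.* m
  lem₂ = ℤ-Solver.solve-∀

+-cancelˡ : ∀ x {y z} → x ℤ.+ y ≡ x ℤ.+ z → y ≡ z
+-cancelˡ x {y} {z} eq = trans (lem x y) (trans (cong (ℤ._- x) eq) (sym (lem x z)))
  where
  lem : ∀ x y → y ≡ (x ℤ.+ y) ℤ.- x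
  lem = ℤ-Solver.solve-∀

sum-nonNeg : ∀ {n} {f : Fin n → ℤ} → (∀ i → ℤ.0ℤ ℤ.≤ f i) → ℤ.0ℤ ℤ.≤ Σℤ.sum f
sum-nonNeg {zero}  0≤f = ℤ.≤-refl
sum-nonNeg {suc n} 0≤f = ℤ.+-mono-≤ (0≤f zero) (sum-nonNeg (0≤f ∘ suc))

term≤sum : ∀ {n} {f : Fin n → ℤ} → (∀ i → ℤ.0ℤ ℤ.≤ f i) → ∀ i → f i ℤ.≤ Σℤ.sum f
term≤sum {f = f} 0≤f zero    = subst (ℤ._≤ Σℤ.sum f) (ℤ.+-identityʳ (f zero))
  (ℤ.+-monoʳ-≤ (f zero) (sum-nonNeg (0≤f ∘ suc)))
term≤sum {f = f} 0≤f (suc i) = subst (ℤ._≤ Σℤ.sum f) (ℤ.+-identityˡ (f (suc i)))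
  (ℤ.+-mono-≤ (0≤f zero) (term≤sum (0≤f ∘ suc) i))

sum-pos : ∀ {n} (c : Vec ℕ n) → Σℤ.sum (λ i → + lookup c i) ≡ + Vec.sum c
sum-pos []      = refl
sum-pos (a ∷ c) = cong (ℤ._+_ (+ a)) (sum-pos c)

-- The index found is that of a maximal entry; multiplying by the number of entries avoids dividing
-- the sum.
average≤max : ∀ {n} (f : Fin (suc n) → ℤ) → ∃[ i ] Σℤ.sum f ℤ.≤ + suc n ℤ.* f i
average≤max {zero}  f = zero , ℤ.≤-reflexive (lem (f zero))
  where
  lem : ∀ x → x ℤ.+ + 0 ≡ + 1 ℤ.* x
  lem = ℤ-Solver.solve-∀
average≤max {suc n} f with average≤max (f ∘ suc)
... | i , avg with ℤ.≤-total (f zero) (f (suc i))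
... | inj₁ le = suc i , ℤ.≤-trans (ℤ.+-mono-≤ le avg) (ℤ.≤-reflexive (lem (+ suc n) (f (suc i))))
  where
  lem : ∀ n x → x ℤ.+ n ℤ.* x ≡ (+ 1 ℤ.+ n) ℤ.* x
  lem = ℤ-Solver.solve-∀
... | inj₂ ge = zero , ℤ.≤-trans
    (ℤ.+-monoʳ-≤ (f zero) (ℤ.≤-trans avg (ℤ.*-monoˡ-≤-nonNeg (+ suc n) ge)))
    (ℤ.≤-reflexive (lem (+ suc n) (f zero)))
  where
  lem : ∀ n x → x ℤ.+ n ℤ.* x ≡ (+ 1 ℤ.+ n) ℤ.* x
  lem = ℤ-Solver.solve-∀

total : ∀ {X : Set} → (X → ℤ) → List X → ℤ
total f []      = ℤ.0ℤ
total f (s ∷ S) = f s ℤ.+ total f S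

module _ {X : Set} where

  total-++ : ∀ (f : X → ℤ) S S′ → total f (S ++ S′) ≡ total f S ℤ.+ total f S′
  total-++ f []      S′ = sym (ℤ.+-identityˡ _)
  total-++ f (s ∷ S) S′ = trans (cong (ℤ._+_ (f s)) (total-++ f S S′)) (sym (ℤ.+-assoc (f s) _ _))

  total-take-drop : ∀ (f : X → ℤ) k S → total f S ≡ total f (take k S) ℤ.+ total f (drop k S)
  total-take-drop f k S = trans (cong (total f) (sym (List.take++drop≡id k S))) (total-++ f (take k S) (drop k S))

  total-nonNeg : ∀ {f : X → ℤ} → (∀ s → ℤ.0ℤ ℤ.≤ f s) → ∀ S → ℤ.0ℤ ℤ.≤ total f S
  total-nonNeg 0≤f []      = ℤ.≤-refl
  total-nonNeg 0≤f (s ∷ S) = ℤ.+-mono-≤ (0≤f s) (total-nonNeg 0≤f S)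

  total-take-mono : ∀ {f : X → ℤ} → (∀ s → ℤ.0ℤ ℤ.≤ f s) → ∀ {k l} → k ℕ.≤ l → ∀ S →
    total f (take k S) ℤ.≤ total f (take l S)
  total-take-mono 0≤f {l = l} z≤n S     = total-nonNeg 0≤f (take l S)
  total-take-mono 0≤f (s≤s k≤l) []      = ℤ.≤-refl
  total-take-mono {f} 0≤f (s≤s k≤l) (s ∷ S) = ℤ.+-monoʳ-≤ (f s) (total-take-mono 0≤f k≤l S)

  total-≤ : ∀ {f : X → ℤ} {b} → (∀ s → f s ℤ.≤ b) → ∀ S → total f S ℤ.≤ b ℤ.* + length S
  total-≤ {b = b} f≤b []      = ℤ.≤-reflexive (sym (ℤ.*-zeroʳ b))
  total-≤ {b = b} f≤b (s ∷ S) = ℤ.≤-trans (ℤ.+-mono-≤ (f≤b s) (total-≤ f≤b S)) (ℤ.≤-reflexive (lem b (+ length S)))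
    where
    lem : ∀ b n → b ℤ.+ b ℤ.* n ≡ b ℤ.* (+ 1 ℤ.+ n)
    lem = ℤ-Solver.solve-∀

  total-1 : ∀ (S : List X) → total (λ _ → ℤ.1ℤ) S ≡ + length S
  total-1 []      = refl
  total-1 (s ∷ S) = cong (ℤ._+_ (+ 1)) (total-1 S)

-- Homogeneous coordinates: the height followed by the coordinates of the point.
up : ∀ {d} → ℤ → Vec ℤ d → Fin (suc d) → ℤ
up m x zero    = m
up m x (suc j) = lookup x j

up-+ : ∀ {d} m k (x y : Vec ℤ d) j → up (m ℤ.+ k) (x +ᵛ y) j ≡ up m x j ℤ.+ up k y j
up-+ m k x y zero    = refl
up-+ m k x y (suc j) = Vec.lookup-zipWith ℤ._+_ j x y

up-injective : ∀ {d} {m k} {x y : Vec ℤ d} → (∀ j → up m x j ≡ up k y j) → x ≡ y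
up-injective eq = lookup-ext (eq ∘ suc)

-- Coordinate zero is the sum of the coefficients, so one equation for all `j` fixes both the total
-- weight and the point.
comb : ∀ {n d} → (Fin n → Vec ℤ d) → (Fin n → ℤ) → Fin (suc d) → ℤ
comb v c j = Σℤ.sum (λ i → c i ℤ.* up ℤ.1ℤ (v i) j)

module _ {n d} (v : Fin n → Vec ℤ d) where

  comb-cong : ∀ {b c} → (∀ i → b i ≡ c i) → ∀ j → comb v b j ≡ comb v c j
  comb-cong eq j = Σℤ.sum-cong-≗ (λ i → cong (ℤ._* up ℤ.1ℤ (v i) j) (eq i))

  comb-+ : ∀ b c j → comb v (λ i → b i ℤ.+ c i) j ≡ comb v b j ℤ.+ comb v c j
  comb-+ b c j = trans (Σℤ.sum-cong-≗ (λ i → ℤ.*-distribʳ-+ (up ℤ.1ℤ (v i) j) (b i) (c i)))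
                       (Σℤ.∑-distrib-+ (λ i → b i ℤ.* up ℤ.1ℤ (v i) j) (λ i → c i ℤ.* up ℤ.1ℤ (v i) j))

  comb-* : ∀ r c j → comb v (λ i → r ℤ.* c i) j ≡ r ℤ.* comb v c j
  comb-* r c j = trans (Σℤ.sum-cong-≗ (λ i → ℤ.*-assoc r (c i) (up ℤ.1ℤ (v i) j)))
                       (sym (Σℤ.*-distribˡ-sum r (λ i → c i ℤ.* up ℤ.1ℤ (v i) j)))

  comb-- : ∀ b c j → comb v (λ i → b i ℤ.- c i) j ≡ comb v b j ℤ.- comb v c j
  comb-- b c j = begin
    comb v (λ i → b i ℤ.- c i) j                      ≡⟨ comb-cong (λ i → lem (b i) (c i)) j ⟩
    comb v (λ i → b i ℤ.+ ℤ.-1ℤ ℤ.* c i) j            ≡⟨ comb-+ b (λ i → ℤ.-1ℤ ℤ.* c i) j ⟩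
    comb v b j ℤ.+ comb v (λ i → ℤ.-1ℤ ℤ.* c i) j     ≡⟨ cong (ℤ._+_ (comb v b j)) (comb-* ℤ.-1ℤ c j) ⟩
    comb v b j ℤ.+ ℤ.-1ℤ ℤ.* comb v c j               ≡⟨ lem (comb v b j) (comb v c j) ⟨
    comb v b j ℤ.- comb v c j                         ∎
    where
    open ≡-Reasoning
    lem : ∀ x y → x ℤ.- y ≡ x ℤ.+ ℤ.- + 1 ℤ.* y
    lem = ℤ-Solver.solve-∀

  comb-zero : ∀ j → comb v (λ _ → ℤ.0ℤ) j ≡ ℤ.0ℤ
  comb-zero j = Σℤ.sum-replicate-zero n

  comb-single : ∀ i r j → comb v (single i r) j ≡ r ℤ.* up ℤ.1ℤ (v i) j
  comb-single i r j = sum-single-* i r (λ l → up ℤ.1ℤ (v l) j)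

  comb-height : ∀ c → comb v c zero ≡ Σℤ.sum c
  comb-height c = Σℤ.sum-cong-≗ (λ i → ℤ.*-identityʳ (c i))

-- Barycentric coordinates with cleared denominators

lookup-ι : ∀ {d} (x : Vec ℤ d) j → lookup (ι x) j ≡ toℚ (lookup x j)
lookup-ι x j = trans (Vec.lookup-map j fromℤ x) (fromℤ≡toℚ (lookup x j))

-- Used with t the reciprocal of the height of `x`, which turns homogeneous coordinates back into a
-- point.
scale : ∀ {d} → ℚ → Vec ℤ d → Vec ℚ d
scale t = Vec.map (λ z → toℚ z ℚ.* t)

scale-1 : ∀ {d} (x : Vec ℤ d) → scale 1ℚ x ≡ ι x
scale-1 = Vec.map-cong (λ z → trans (ℚ.*-identityʳ (toℚ z)) (sym (fromℤ≡toℚ z)))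

comb-suc : ∀ {n d} (p : Fin n → Vec ℤ d) (c : Fin n → ℤ) j →
  toℚ (comb p c (suc j)) ≡ Σℚ (λ i → toℚ (c i) ℚ.* lookup (ι (p i)) j)
comb-suc p c j = trans (toℚ-sum (λ i → c i ℤ.* lookup (p i) j))
  (Σq.sum-cong-≗ λ i → trans (toℚ-* (c i) (lookup (p i) j)) (cong (toℚ (c i) ℚ.*_) (sym (lookup-ι (p i) j))))

-- The weights are P/(M·H). They sum to 1 because coordinate zero of the hypothesis reads: the sum
-- of `P` is M·H.
comb-nonNeg⇒Conv : ∀ {n d} (p : Fin n → Vec ℤ d) (P : Fin n → ℤ) → (∀ i → ℤ.0ℤ ℤ.≤ P i) →
  ∀ M .{{_ : NonZero M}} H {t} → 0ℚ ℚ.≤ t → fromℕ H ℚ.* t ≡ 1ℚ → ∀ y →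
  (∀ j → comb p P j ≡ + M ℤ.* up (+ H) y j) → Conv (ι ∘ p) (scale t y)
comb-nonNeg⇒Conv p P 0≤P M H {t} 0≤t Ht≡1 y eq = w , 0≤w , Σw≡1 , Σwp
  where
  open ≡-Reasoning
  r = proj₁ (recip M)
  0<r = proj₁ (proj₂ (recip M))
  Mr≡1 = proj₂ (proj₂ (recip M))
  w = λ i → toℚ (P i) ℚ.* (r ℚ.* t)
  0≤w : ∀ i → 0ℚ ℚ.≤ w i
  0≤w i = 0≤a∧0≤b⇒0≤a*b (subst (ℚ._≤ toℚ (P i)) (sym 0≡toℚ) (toℚ-mono-≤ (0≤P i))) (0≤a∧0≤b⇒0≤a*b (ℚ.<⇒≤ 0<r) 0≤t)
  lem : ∀ M h r t → (M ℚ.* h) ℚ.* (r ℚ.* t) ≡ (M ℚ.* r) ℚ.* (h ℚ.* t)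
  lem = Solver.solve-∀ ℚ-ring
  cancel : ∀ z → toℚ (+ M ℤ.* z) ℚ.* (r ℚ.* t) ≡ toℚ z ℚ.* t
  cancel z = begin
    toℚ (+ M ℤ.* z) ℚ.* (r ℚ.* t)            ≡⟨ cong (ℚ._* (r ℚ.* t)) (toℚ-* (+ M) z) ⟩
    fromℕ M ℚ.* toℚ z ℚ.* (r ℚ.* t)          ≡⟨ lem (fromℕ M) (toℚ z) r t ⟩
    (fromℕ M ℚ.* r) ℚ.* (toℚ z ℚ.* t)        ≡⟨ cong (ℚ._* (toℚ z ℚ.* t)) Mr≡1 ⟩
    1ℚ ℚ.* (toℚ z ℚ.* t)                     ≡⟨ ℚ.*-identityˡ _ ⟩
    toℚ z ℚ.* t                              ∎
  Σw≡1 : Σℚ w ≡ 1ℚ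
  Σw≡1 = begin
    Σℚ w                                     ≡⟨ Σq.*-distribʳ-sum (r ℚ.* t) (toℚ ∘ P) ⟨
    Σℚ (toℚ ∘ P) ℚ.* (r ℚ.* t)               ≡⟨ cong (ℚ._* (r ℚ.* t)) (toℚ-sum P) ⟨
    toℚ (Σℤ.sum P) ℚ.* (r ℚ.* t)             ≡⟨ cong (λ z → toℚ z ℚ.* (r ℚ.* t)) (trans (sym (comb-height p P)) (eq zero)) ⟩
    toℚ (+ M ℤ.* + H) ℚ.* (r ℚ.* t)          ≡⟨ cancel (+ H) ⟩
    fromℕ H ℚ.* t                            ≡⟨ Ht≡1 ⟩
    1ℚ                                       ∎
  swap : ∀ a b c → a ℚ.* b ℚ.* c ≡ a ℚ.* c ℚ.* b
  swap = Solver.solve-∀ ℚ-ring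
  Σwp : ∀ j → Σℚ (λ i → w i ℚ.* lookup (ι (p i)) j) ≡ lookup (scale t y) j
  Σwp j = begin
    Σℚ (λ i → w i ℚ.* lookup (ι (p i)) j)                          ≡⟨ Σq.sum-cong-≗ (λ i → swap (toℚ (P i)) (r ℚ.* t) (lookup (ι (p i)) j)) ⟩
    Σℚ (λ i → toℚ (P i) ℚ.* lookup (ι (p i)) j ℚ.* (r ℚ.* t))      ≡⟨ Σq.*-distribʳ-sum (r ℚ.* t) (λ i → toℚ (P i) ℚ.* lookup (ι (p i)) j) ⟨
    Σℚ (λ i → toℚ (P i) ℚ.* lookup (ι (p i)) j) ℚ.* (r ℚ.* t)      ≡⟨ cong (ℚ._* (r ℚ.* t)) (comb-suc p P j) ⟨
    toℚ (comb p P (suc j)) ℚ.* (r ℚ.* t)                           ≡⟨ cong (λ z → toℚ z ℚ.* (r ℚ.* t)) (eq (suc j)) ⟩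
    toℚ (+ M ℤ.* lookup y j) ℚ.* (r ℚ.* t)                         ≡⟨ cancel (lookup y j) ⟩
    toℚ (lookup y j) ℚ.* t                                         ≡⟨ Vec.lookup-map j (λ z → toℚ z ℚ.* t) y ⟨
    lookup (scale t y) j                                           ∎

point∈Conv : ∀ {n d} (p : Fin n → Vec ℤ d) i → Conv (ι ∘ p) (ι (p i))
point∈Conv p i = subst (Conv (ι ∘ p)) (scale-1 (p i))
  (comb-nonNeg⇒Conv p (single i (+ 1)) (0≤single i (+≤+ z≤n)) 1 1 (ℚ.nonNegative⁻¹ 1ℚ)
    (trans (ℚ.*-identityʳ (fromℕ 1)) (sym 1≡toℚ)) (p i) (comb-single p i (+ 1)))

-- Serves twice: for the denominators of the weights of a single point, and then for one denominator
-- common to all points of A.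
commonMultiple : ∀ {n} (Q : Fin n → ℕ → Set) → (∀ i k m → Q i m → Q i (k ℕ.* m)) →
  (∀ i → ∃[ m ] (NonZero m × Q i m)) → ∃[ M ] (NonZero M × (∀ i → Q i M))
commonMultiple {zero}  Q mult ex = 1 , _ , λ ()
commonMultiple {suc n} Q mult ex with ex zero | commonMultiple (Q ∘ suc) (mult ∘ suc) (ex ∘ suc)
... | m , m≢0 , q | M , M≢0 , qs = m ℕ.* M , ℕ.m*n≢0 m M {{m≢0}} {{M≢0}}
  , λ { zero → subst (Q zero) (ℕ.*-comm M m) (mult zero M m q) ; (suc i) → mult (suc i) m M (qs i) }

-- Barycentric coordinates with respect to p, scaled by the common denominator M.
BaryCoord : ∀ {n d} → (Fin n → Vec ℤ d) → Vec ℤ d → ℕ → Set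
BaryCoord {n} p x M = Σ[ κ ∈ (Fin n → ℤ) ] ((∀ i → ℤ.0ℤ ℤ.≤ κ i) × (∀ j → comb p κ j ≡ + M ℤ.* up ℤ.1ℤ x j))

0≤+*z : ∀ k {z} → ℤ.0ℤ ℤ.≤ z → ℤ.0ℤ ℤ.≤ + k ℤ.* z
0≤+*z k {z} 0≤z = subst (ℤ._≤ + k ℤ.* z) (ℤ.*-zeroʳ (+ k)) (ℤ.*-monoˡ-≤-nonNeg (+ k) 0≤z)

baryCoord-multiple : ∀ {n d} (p : Fin n → Vec ℤ d) x k m → BaryCoord p x m → BaryCoord p x (k ℕ.* m)
baryCoord-multiple p x k m (κ , 0≤κ , eq) = (λ i → + k ℤ.* κ i) , (λ i → 0≤+*z k (0≤κ i)) , λ j → begin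
    comb p (λ i → + k ℤ.* κ i) j         ≡⟨ comb-* p (+ k) κ j ⟩
    + k ℤ.* comb p κ j                   ≡⟨ cong (+ k ℤ.*_) (eq j) ⟩
    + k ℤ.* (+ m ℤ.* up ℤ.1ℤ x j)        ≡⟨ ℤ.*-assoc (+ k) (+ m) (up ℤ.1ℤ x j) ⟨
    + k ℤ.* + m ℤ.* up ℤ.1ℤ x j          ≡⟨ cong (ℤ._* up ℤ.1ℤ x j) (ℤ.pos-* k m) ⟨
    + (k ℕ.* m) ℤ.* up ℤ.1ℤ x j          ∎
  where open ≡-Reasoning

clearDenominators : ∀ {n} (w : Fin n → ℚ) → (∀ i → 0ℚ ℚ.≤ w i) →
  ∃[ M ] (NonZero M × (∀ i → ∃[ z ] (ℤ.0ℤ ℤ.≤ z × toℚ z ≡ fromℕ M ℚ.* w i)))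
clearDenominators w 0≤w = commonMultiple _ mult
  (λ i → ↧ₙ (w i) , ℕ.nonZero , ↥ (w i) , 0≤p⇒0≤↥p (0≤w i) , sym (↧*p≡↥ (w i)))
  where
  mult : ∀ i k m → ∃[ z ] (ℤ.0ℤ ℤ.≤ z × toℚ z ≡ fromℕ m ℚ.* w i) →
                   ∃[ z ] (ℤ.0ℤ ℤ.≤ z × toℚ z ≡ fromℕ (k ℕ.* m) ℚ.* w i)
  mult i k m (z , 0≤z , eq) = + k ℤ.* z , 0≤+*z k 0≤z , (begin
    toℚ (+ k ℤ.* z)                  ≡⟨ toℚ-* (+ k) z ⟩
    fromℕ k ℚ.* toℚ z                ≡⟨ cong (fromℕ k ℚ.*_) eq ⟩
    fromℕ k ℚ.* (fromℕ m ℚ.* w i)    ≡⟨ ℚ.*-assoc (fromℕ k) (fromℕ m) (w i) ⟨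
    fromℕ k ℚ.* fromℕ m ℚ.* w i      ≡⟨ cong (ℚ._* w i) (fromℕ-* k m) ⟨
    fromℕ (k ℕ.* m) ℚ.* w i          ∎)
    where open ≡-Reasoning

Conv⇒BaryCoord : ∀ {n d} (p : Fin n → Vec ℤ d) x → Conv (ι ∘ p) (ι x) → ∃[ M ] (NonZero M × BaryCoord p x M)
Conv⇒BaryCoord {n} {d} p x (w , 0≤w , Σw≡1 , Σwp) = M , proj₁ (proj₂ D) , κ , (λ i → proj₁ (proj₂ (Z i))) , eq
  where
  open ≡-Reasoning
  D = clearDenominators w 0≤w
  M = proj₁ D
  Z = proj₂ (proj₂ D)
  κ : Fin n → ℤ
  κ i = proj₁ (Z i)
  κ≡ : ∀ i → toℚ (κ i) ≡ fromℕ M ℚ.* w i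
  κ≡ i = proj₂ (proj₂ (Z i))
  eq : ∀ j → comb p κ j ≡ + M ℤ.* up ℤ.1ℤ x j
  eq zero = toℚ-injective (begin
    toℚ (comb p κ zero)              ≡⟨ cong toℚ (comb-height p κ) ⟩
    toℚ (Σℤ.sum κ)                   ≡⟨ toℚ-sum κ ⟩
    Σℚ (toℚ ∘ κ)                     ≡⟨ Σq.sum-cong-≗ κ≡ ⟩
    Σℚ (λ i → fromℕ M ℚ.* w i)       ≡⟨ Σq.*-distribˡ-sum (fromℕ M) w ⟨
    fromℕ M ℚ.* Σℚ w                 ≡⟨ cong (fromℕ M ℚ.*_) Σw≡1 ⟩
    fromℕ M ℚ.* 1ℚ                   ≡⟨ ℚ.*-identityʳ (fromℕ M) ⟩
    fromℕ M                          ≡⟨ cong toℚ (ℤ.*-identityʳ (+ M)) ⟨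
    toℚ (+ M ℤ.* ℤ.1ℤ)               ∎)
  eq (suc j) = toℚ-injective (begin
    toℚ (comb p κ (suc j))                                   ≡⟨ comb-suc p κ j ⟩
    Σℚ (λ i → toℚ (κ i) ℚ.* lookup (ι (p i)) j)              ≡⟨ Σq.sum-cong-≗ (λ i → trans (cong (ℚ._* lookup (ι (p i)) j) (κ≡ i)) (ℚ.*-assoc (fromℕ M) (w i) (lookup (ι (p i)) j))) ⟩
    Σℚ (λ i → fromℕ M ℚ.* (w i ℚ.* lookup (ι (p i)) j))      ≡⟨ Σq.*-distribˡ-sum (fromℕ M) (λ i → w i ℚ.* lookup (ι (p i)) j) ⟨
    fromℕ M ℚ.* Σℚ (λ i → w i ℚ.* lookup (ι (p i)) j)        ≡⟨ cong (fromℕ M ℚ.*_) (trans (Σwp j) (lookup-ι x j)) ⟩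
    fromℕ M ℚ.* toℚ (lookup x j)                             ≡⟨ toℚ-* (+ M) (lookup x j) ⟨
    toℚ (+ M ℤ.* lookup x j)                                 ∎)

comb-independent : ∀ {n d} (p : Fin n → Vec ℤ d) → AffinelyIndependent (ι ∘ p) →
  ∀ c → (∀ j → comb p c j ≡ ℤ.0ℤ) → ∀ i → c i ≡ ℤ.0ℤ
comb-independent p ind c eq i = toℚ-injective (trans (ind (toℚ ∘ c) sum≡0 moment≡0 i) 0≡toℚ)
  where
  sum≡0 : Σℚ (toℚ ∘ c) ≡ 0ℚ
  sum≡0 = trans (sym (toℚ-sum c)) (trans (cong toℚ (trans (sym (comb-height p c)) (eq zero))) (sym 0≡toℚ))
  moment≡0 : ∀ j → Σℚ (λ i → toℚ (c i) ℚ.* lookup (ι (p i)) j) ≡ 0ℚ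
  moment≡0 j = trans (sym (comb-suc p c j)) (trans (cong toℚ (eq (suc j))) (sym 0≡toℚ))

comb-sum : ∀ {a n d} (p : Fin n → Vec ℤ d) (W : Fin a → ℤ) (κ : Fin a → Fin n → ℤ) j →
  comb p (λ l → Σℤ.sum (λ s → W s ℤ.* κ s l)) j ≡ Σℤ.sum (λ s → W s ℤ.* comb p (κ s) j)
comb-sum p W κ j = begin
  Σℤ.sum (λ l → Σℤ.sum (λ s → W s ℤ.* κ s l) ℤ.* V l)       ≡⟨ Σℤ.sum-cong-≗ (λ l → Σℤ.*-distribʳ-sum (V l) (λ s → W s ℤ.* κ s l)) ⟩
  Σℤ.sum (λ l → Σℤ.sum (λ s → W s ℤ.* κ s l ℤ.* V l))       ≡⟨ Σℤ.∑-comm (λ l s → W s ℤ.* κ s l ℤ.* V l) ⟩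
  Σℤ.sum (λ s → Σℤ.sum (λ l → W s ℤ.* κ s l ℤ.* V l))       ≡⟨ Σℤ.sum-cong-≗ (λ s → comb-* p (W s) (κ s) j) ⟩
  Σℤ.sum (λ s → W s ℤ.* comb p (κ s) j)                     ∎
  where
  open ≡-Reasoning
  V = λ l → up ℤ.1ℤ (p l) j

sum-zero : ∀ {n} (f : Fin n → ℤ) → (∀ i → f i ≡ ℤ.0ℤ) → Σℤ.sum f ≡ ℤ.0ℤ
sum-zero {n} f eq = trans (Σℤ.sum-cong-≗ eq) (Σℤ.sum-replicate-zero n)

sum≡0⇒≡0 : ∀ {n} {f : Fin n → ℤ} → (∀ i → ℤ.0ℤ ℤ.≤ f i) → Σℤ.sum f ≡ ℤ.0ℤ → ∀ i → f i ≡ ℤ.0ℤ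
sum≡0⇒≡0 {f = f} 0≤f eq i = ℤ.≤-antisym (subst (f i ℤ.≤_) eq (term≤sum 0≤f i)) (0≤f i)

0≤i*j : ∀ {i j} → ℤ.0ℤ ℤ.≤ i → ℤ.0ℤ ℤ.≤ j → ℤ.0ℤ ℤ.≤ i ℤ.* j
0≤i*j {+ i} (+≤+ _) 0≤j = 0≤+*z i 0≤j

≡single : ∀ {n} (f : Fin n → ℤ) i → (∀ l → l ≢ i → f l ≡ ℤ.0ℤ) → ∀ l → f l ≡ single i (f i) l
≡single f i zero-else l with l Fin.≟ i
... | yes refl = sym (single-same l (f l))
... | no l≢i = trans (zero-else l l≢i) (sym (single-other i l (f i) l≢i))

-- Sequences modulo the lattice of the vertices

module Simplex {d a : ℕ} (v : Fin (suc d) → Vec ℤ d) (pt : Fin a → Vec ℤ d)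
  (independent : ∀ c → (∀ j → comb v c j ≡ ℤ.0ℤ) → ∀ i → c i ≡ ℤ.0ℤ)
  (M : ℕ) .{{M≢0 : NonZero M}}
  (κ : Fin a → Fin (suc d) → ℤ) (0≤κ : ∀ s i → ℤ.0ℤ ℤ.≤ κ s i)
  (κ-coord : ∀ s j → comb v (κ s) j ≡ + M ℤ.* up ℤ.1ℤ (pt s) j)
  where

  private
    instance
      +M-pos : ℤ.Positive (+ M)
      +M-pos = ℤ.positive (+<+ (ℕ.>-nonZero⁻¹ M))

  Seq : Set
  Seq = List (Fin a)

  coord : Seq → Fin (suc d) → ℤ
  coord S i = total (λ s → κ s i) S

  pos : Seq → Fin (suc d) → ℤ
  pos S j = total (λ s → up ℤ.1ℤ (pt s) j) S

  pos-height : ∀ S → pos S zero ≡ + length S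
  pos-height = total-1

  coord-pos : ∀ S j → comb v (coord S) j ≡ + M ℤ.* pos S j
  coord-pos []      j = trans (comb-zero v j) (sym (ℤ.*-zeroʳ (+ M)))
  coord-pos (s ∷ S) j = begin
    comb v (λ i → κ s i ℤ.+ coord S i) j                   ≡⟨ comb-+ v (κ s) (coord S) j ⟩
    comb v (κ s) j ℤ.+ comb v (coord S) j                  ≡⟨ cong₂ ℤ._+_ (κ-coord s j) (coord-pos S j) ⟩
    + M ℤ.* up ℤ.1ℤ (pt s) j ℤ.+ + M ℤ.* pos S j           ≡⟨ ℤ.*-distribˡ-+ (+ M) (up ℤ.1ℤ (pt s) j) (pos S j) ⟨
    + M ℤ.* (up ℤ.1ℤ (pt s) j ℤ.+ pos S j)                 ∎
    where open ≡-Reasoning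

  comb-injective : ∀ b c → (∀ j → comb v b j ≡ comb v c j) → ∀ i → b i ≡ c i
  comb-injective b c eq i = ℤ.i-j≡0⇒i≡j (b i) (c i)
    (independent (λ i → b i ℤ.- c i) (λ j → trans (comb-- v b c j) (ℤ.i≡j⇒i-j≡0 (eq j))) i)

  sum-κ : ∀ s → Σℤ.sum (κ s) ≡ + M
  sum-κ s = trans (sym (comb-height v (κ s))) (trans (κ-coord s zero) (ℤ.*-identityʳ (+ M)))

  -- `coord` holds M times the barycentric coordinates of a sum, so by uniqueness of these
  -- coordinates divisibility by M means that the two partial sums differ by an element of Λ. In
  -- this form the relation is decidable.
  Congruent : Seq → ℕ → ℕ → Set
  Congruent S k l = ∀ i → + M ∣ coord (take l S) i ℤ.- coord (take k S) i

  -- No two partial sums agree modulo the lattice spanned by the homogenised vertices.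
  Irreducible : Seq → Set
  Irreducible S = ∀ {k l} → k ℕ.< l → l ℕ.≤ length S → ¬ Congruent S k l

  irreducible? : ∀ S → Irreducible S ⊎ (∃[ k ] ∃[ l ] (k ℕ.< l × l ℕ.≤ length S × Congruent S k l))
  irreducible? S with Fin.any? {n = suc (length S)} (λ k → Fin.any? {n = suc (length S)} (λ l →
    (toℕ k ℕ.<? toℕ l) ×-dec Fin.all? (λ i → + M ∣? coord (take (toℕ l) S) i ℤ.- coord (take (toℕ k) S) i)))
  ... | yes (k , l , k<l , con) = inj₂ (toℕ k , toℕ l , k<l , Fin.toℕ≤pred[n] l , con)
  ... | no none = inj₁ irr
    where
    irr : Irreducible S
    irr {k} {l} k<l l≤n con = none
      ( Fin.fromℕ< k< , Fin.fromℕ< l<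
      , subst₂ ℕ._<_ (sym (Fin.toℕ-fromℕ< k<)) (sym (Fin.toℕ-fromℕ< l<)) k<l
      , subst₂ (Congruent S) {k} {_} {l} (sym (Fin.toℕ-fromℕ< k<)) (sym (Fin.toℕ-fromℕ< l<)) con )
      where
      l< : l ℕ.< suc (length S)
      l< = s≤s l≤n
      k< : k ℕ.< suc (length S)
      k< = ℕ.<-trans k<l l<

  -- The sign of `c i` is left free: membership in the set attached to the vertex i does not limit
  -- the number of summands, and copies of `v i` are then subtracted to return to the height of `y`.
  Represents : Fin (suc d) → (Fin (suc d) → ℤ) → Seq → Set
  Represents i y S = Σ[ c ∈ (Fin (suc d) → ℤ) ]
    ((∀ l → l ≢ i → ℤ.0ℤ ℤ.≤ c l) × (∀ j → y j ≡ pos S j ℤ.+ comb v c j))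

  shorten : ∀ {i y S k l} → k ℕ.< l → l ℕ.≤ length S → Congruent S k l → Represents i y S →
    ∃[ S′ ] (length S′ ℕ.< length S × Represents i y S′)
  shorten {i} {y} {S} {k} {l} k<l l≤n con (c , 0≤c , eq) =
    take k S ++ drop l S , shorter , (λ t → q t ℤ.+ c t) , (λ t t≢i → ℤ.+-mono-≤ (0≤q t) (0≤c t t≢i)) , eq′
    where
    q : Fin (suc d) → ℤ
    q t = quotient (con t)
    Δ≡ : ∀ t → coord (take l S) t ℤ.- coord (take k S) t ≡ + M ℤ.* q t
    Δ≡ t = trans (_∣_.equality (con t)) (ℤ.*-comm (q t) (+ M))
    -- All `κ` are nonnegative, so coordinates can only grow from a prefix to a longer one.
    0≤q : ∀ t → ℤ.0ℤ ℤ.≤ q t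
    0≤q t = ℤ.*-cancelˡ-≤-pos ℤ.0ℤ (q t) (+ M)
      (subst₂ ℤ._≤_ (sym (ℤ.*-zeroʳ (+ M))) (Δ≡ t)
        (ℤ.i≤j⇒0≤j-i (total-take-mono (λ s → 0≤κ s t) (ℕ.<⇒≤ k<l) S)))
    block : ∀ j → pos (take l S) j ℤ.- pos (take k S) j ≡ comb v q j
    block j = ℤ.*-cancelˡ-≡ (+ M) _ _ (begin
      + M ℤ.* (pos (take l S) j ℤ.- pos (take k S) j)                  ≡⟨ lem (+ M) (pos (take l S) j) (pos (take k S) j) ⟩
      + M ℤ.* pos (take l S) j ℤ.- + M ℤ.* pos (take k S) j            ≡⟨ cong₂ ℤ._-_ (coord-pos (take l S) j) (coord-pos (take k S) j) ⟨
      comb v (coord (take l S)) j ℤ.- comb v (coord (take k S)) j      ≡⟨ comb-- v (coord (take l S)) (coord (take k S)) j ⟨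
      comb v (λ t → coord (take l S) t ℤ.- coord (take k S) t) j       ≡⟨ comb-cong v Δ≡ j ⟩
      comb v (λ t → + M ℤ.* q t) j                                     ≡⟨ comb-* v (+ M) q j ⟩
      + M ℤ.* comb v q j                                               ∎)
      where
      open ≡-Reasoning
      lem : ∀ m x y → m ℤ.* (x ℤ.- y) ≡ m ℤ.* x ℤ.- m ℤ.* y
      lem = ℤ-Solver.solve-∀
    eq′ : ∀ j → y j ≡ pos (take k S ++ drop l S) j ℤ.+ comb v (λ t → q t ℤ.+ c t) j
    eq′ j = begin
      y j                                                    ≡⟨ eq j ⟩
      pos S j ℤ.+ comb v c j                                 ≡⟨ cong (ℤ._+ comb v c j) (total-take-drop f l S) ⟩
      pos (take l S) j ℤ.+ pos (drop l S) j ℤ.+ comb v c j   ≡⟨ lem (pos (take l S) j) (pos (take k S) j) (pos (drop l S) j) (comb v c j) ⟩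
      pos (take k S) j ℤ.+ pos (drop l S) j ℤ.+ (pos (take l S) j ℤ.- pos (take k S) j ℤ.+ comb v c j)
        ≡⟨ cong₂ ℤ._+_ (sym (total-++ f (take k S) (drop l S))) (trans (cong (ℤ._+ comb v c j) (block j)) (sym (comb-+ v q c j))) ⟩
      pos (take k S ++ drop l S) j ℤ.+ comb v (λ t → q t ℤ.+ c t) j ∎
      where
      open ≡-Reasoning
      f = λ s → up ℤ.1ℤ (pt s) j
      lem : ∀ x y z w → x ℤ.+ z ℤ.+ w ≡ y ℤ.+ z ℤ.+ (x ℤ.- y ℤ.+ w)
      lem = ℤ-Solver.solve-∀
    shorter : length (take k S ++ drop l S) ℕ.< length S
    shorter = begin-strict
      length (take k S ++ drop l S)          ≡⟨ List.length-++ (take k S) ⟩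
      length (take k S) ℕ.+ length (drop l S) ≡⟨ cong₂ ℕ._+_ (List.length-take k S) (List.length-drop l S) ⟩
      k ℕ.⊓ length S ℕ.+ (length S ℕ.∸ l)     ≤⟨ ℕ.+-monoˡ-≤ (length S ℕ.∸ l) (ℕ.m⊓n≤m k (length S)) ⟩
      k ℕ.+ (length S ℕ.∸ l)                  <⟨ ℕ.+-monoˡ-< (length S ℕ.∸ l) k<l ⟩
      l ℕ.+ (length S ℕ.∸ l)                  ≡⟨ ℕ.m+[n∸m]≡n l≤n ⟩
      length S                                ∎
      where open ℕ.≤-Reasoning

  reduce : ∀ {i y S} → Represents i y S → ∃[ S′ ] (Irreducible S′ × Represents i y S′)
  reduce {i} {y} {S} = go S (<-wellFounded (length S))
    where
    go : ∀ S → Acc ℕ._<_ (length S) → Represents i y S → ∃[ S′ ] (Irreducible S′ × Represents i y S′)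
    go S (acc rec) rep with irreducible? S
    ... | inj₁ irr = S , irr , rep
    ... | inj₂ (k , l , k<l , l≤n , con) with shorten k<l l≤n con rep
    ... | S′ , shorter , rep′ = go S′ (rec shorter) rep′

  -- By `comb-injective` the vector on the left depends on `y` alone. This makes representations
  -- belonging to different vertices comparable.
  coordinates : ∀ {i y S} ((c , _) : Represents i y S) → ∀ j →
    comb v (λ t → coord S t ℤ.+ + M ℤ.* c t) j ≡ + M ℤ.* y j
  coordinates {i} {y} {S} (c , _ , eq) j = begin
    comb v (λ t → coord S t ℤ.+ + M ℤ.* c t) j              ≡⟨ comb-+ v (coord S) (λ t → + M ℤ.* c t) j ⟩
    comb v (coord S) j ℤ.+ comb v (λ t → + M ℤ.* c t) j     ≡⟨ cong₂ ℤ._+_ (coord-pos S j) (comb-* v (+ M) c j) ⟩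
    + M ℤ.* pos S j ℤ.+ + M ℤ.* comb v c j                  ≡⟨ ℤ.*-distribˡ-+ (+ M) (pos S j) (comb v c j) ⟨
    + M ℤ.* (pos S j ℤ.+ comb v c j)                        ≡⟨ cong (+ M ℤ.*_) (eq j) ⟨
    + M ℤ.* y j                                             ∎
    where open ≡-Reasoning

  -- Families of lattice points attached to the partial sums

  module _ (S : Seq) where

    private n = length S

    -- A composition of m, with n ∸ k further copies of the vertex v zero, so that adding it
    -- to the k-th partial sum gives a point of height m + n whatever k is.
    filling : ∀ k → Vec ℕ (suc d) → Fin (suc d) → ℤ
    filling k c i = + lookup (addHead (n ℕ.∸ k) c) i

    latticePoint : ∀ m → Fin (suc n) → Fin (length (compositions d m)) → Vec ℤ d
    latticePoint m k j = Vec.tabulate λ t →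
      pos (take (toℕ k) S) (suc t) ℤ.+ comb v (filling (toℕ k) (List.lookup (compositions d m) j)) (suc t)

    latticeCoord : ∀ m → Fin (suc n) → Fin (length (compositions d m)) → Fin (suc d) → ℤ
    latticeCoord m k j i = coord (take (toℕ k) S) i ℤ.+ + M ℤ.* filling (toℕ k) (List.lookup (compositions d m) j) i

    0≤latticeCoord : ∀ m k j i → ℤ.0ℤ ℤ.≤ latticeCoord m k j i
    0≤latticeCoord m k j i = ℤ.+-mono-≤ (total-nonNeg (λ s → 0≤κ s i) (take (toℕ k) S))
      (subst (ℤ.0ℤ ℤ.≤_) (ℤ.pos-* M _) (+≤+ z≤n))

    latticePoint-height : ∀ m (k : Fin (suc n)) j →
      pos (take (toℕ k) S) zero ℤ.+ comb v (filling (toℕ k) (List.lookup (compositions d m) j)) zero ≡ + (m ℕ.+ n)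
    latticePoint-height m k j = begin
      pos (take k′ S) zero ℤ.+ comb v (filling k′ c) zero   ≡⟨ cong₂ ℤ._+_ (pos-height (take k′ S)) (comb-height v (filling k′ c)) ⟩
      + length (take k′ S) ℤ.+ Σℤ.sum (filling k′ c)        ≡⟨ cong₂ ℤ._+_ (cong +_ length-prefix) (sum-pos (addHead (n ℕ.∸ k′) c)) ⟩
      + (k′ ℕ.+ Vec.sum (addHead (n ℕ.∸ k′) c))             ≡⟨ cong (λ x → + (k′ ℕ.+ x)) (sum-addHead (n ℕ.∸ k′) c) ⟩
      + (k′ ℕ.+ (n ℕ.∸ k′ ℕ.+ Vec.sum c))                   ≡⟨ cong +_ (ℕ.+-assoc k′ (n ℕ.∸ k′) (Vec.sum c)) ⟨
      + (k′ ℕ.+ (n ℕ.∸ k′) ℕ.+ Vec.sum c)                   ≡⟨ cong₂ (λ x y → + (x ℕ.+ y)) (ℕ.m+[n∸m]≡n k′≤n) (All.lookup (compositions-sum d m) (∈-lookup j)) ⟩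
      + (n ℕ.+ m)                                           ≡⟨ cong +_ (ℕ.+-comm n m) ⟩
      + (m ℕ.+ n)                                           ∎
      where
      open ≡-Reasoning
      k′ = toℕ k
      k′≤n : k′ ℕ.≤ n
      k′≤n = Fin.toℕ≤pred[n] k
      c = List.lookup (compositions d m) j
      length-prefix : length (take k′ S) ≡ k′
      length-prefix = trans (List.length-take k′ S) (ℕ.m≤n⇒m⊓n≡m k′≤n)

    latticePoint-coord : ∀ m k j t → comb v (latticeCoord m k j) t ≡ + M ℤ.* up (+ (m ℕ.+ n)) (latticePoint m k j) t
    latticePoint-coord m k j t = trans
      -- The lattice point is itself represented by a prefix together with the filling; all
      -- coefficients being nonnegative, the choice of the index `zero` is immaterial.
      (coordinates {zero} {y} {take (toℕ k) S} (filling (toℕ k) (List.lookup (compositions d m) j) , (λ _ _ → +≤+ z≤n) , λ _ → refl) t)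
      (cong (+ M ℤ.*_) (y≡ t))
      where
      y : Fin (suc d) → ℤ
      y t = pos (take (toℕ k) S) t ℤ.+ comb v (filling (toℕ k) (List.lookup (compositions d m) j)) t
      y≡ : ∀ t → y t ≡ up (+ (m ℕ.+ n)) (latticePoint m k j) t
      y≡ zero    = latticePoint-height m k j
      y≡ (suc t) = sym (Vec.lookup∘tabulate (y ∘ suc) t)

    congruent : ∀ m k k′ j j′ → (∀ i → latticeCoord m k j i ≡ latticeCoord m k′ j′ i) → Congruent S (toℕ k) (toℕ k′)
    congruent m k k′ j j′ eq i = ∣-difference (+ M) (coord (take (toℕ k) S) i) (coord (take (toℕ k′) S) i)
      (filling (toℕ k) (List.lookup (compositions d m) j) i) (filling (toℕ k′) (List.lookup (compositions d m) j′) i) (eq i)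

    -- Modulo M the filling vanishes, so equal coordinates make the two prefixes congruent and
    -- irreducibility forces k = k′. Cancelling the common prefix then leaves the filling, which
    -- determines the composition.
    latticeCoord-unique : Irreducible S → ∀ m k k′ j j′ → (∀ i → latticeCoord m k j i ≡ latticeCoord m k′ j′ i) → k ≡ k′ × j ≡ j′
    latticeCoord-unique irr m k k′ j j′ eq with ℕ.<-cmp (toℕ k) (toℕ k′)
    ... | tri< k<k′ _ _ = contradiction (congruent m k k′ j j′ eq) (irr k<k′ (Fin.toℕ≤pred[n] k′))
    ... | tri> _ _ k>k′ = contradiction (congruent m k′ k j′ j (sym ∘ eq)) (irr k>k′ (Fin.toℕ≤pred[n] k))
    ... | tri≈ _ k≡k′ _ with Fin.toℕ-injective k≡k′
    ... | refl = refl , lookup-unique-injective (compositions-unique d m)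
            (addHead-injective (n ℕ.∸ toℕ k) (lookup-ext λ i → ℤ.+-injective
              (ℤ.*-cancelˡ-≡ (+ M) _ _ (+-cancelˡ (coord (take (toℕ k) S) i) (eq i)))))

    latticePoint-injective : Irreducible S → ∀ m {k k′ j j′} → latticePoint m k j ≡ latticePoint m k′ j′ → k ≡ k′ × j ≡ j′
    latticePoint-injective irr m {k} {k′} {j} {j′} eq = latticeCoord-unique irr m k k′ j j′ (comb-injective (latticeCoord m k j) (latticeCoord m k′ j′) λ t → trans
      (latticePoint-coord m k j t) (trans (cong (λ y → + M ℤ.* up (+ (m ℕ.+ n)) y t) eq) (sym (latticePoint-coord m k′ j′ t))))

  -- Vertices among the points, and the sign of the free coefficient

  -- A vertex is extreme. Expanding each point in the combination for `v i` gives M·N at i and 0 at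
  -- every l ≠ i; a sum of nonnegative terms vanishes termwise, so a point of nonzero weight has all
  -- its coordinates off i equal to 0 and is `v i`.
  vertex-occurs : ∀ i N .{{_ : NonZero N}} → BaryCoord pt (v i) N → ∃[ s ] pt s ≡ v i
  vertex-occurs i N {{N≢0}} (W , 0≤W , W-coord) with Fin.any? (λ s → ¬? (W s ℤ.≟ ℤ.0ℤ))
  ... | no none = contradiction N≡0 (ℕ.≢-nonZero⁻¹ N)
    where
    N≡0 : N ≡ 0
    N≡0 = ℤ.+-injective (begin
      + N               ≡⟨ ℤ.*-identityʳ (+ N) ⟨
      + N ℤ.* ℤ.1ℤ      ≡⟨ W-coord zero ⟨
      comb pt W zero    ≡⟨ comb-height pt W ⟩
      Σℤ.sum W          ≡⟨ sum-zero W (λ s → decidable-stable (W s ℤ.≟ ℤ.0ℤ) (λ W≢0 → none (s , W≢0))) ⟩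
      + 0               ∎)
      where open ≡-Reasoning
  ... | yes (s , W≢0) = s , up-injective {m = ℤ.1ℤ} {ℤ.1ℤ} (λ j → ℤ.*-cancelˡ-≡ (+ M) _ _ (begin
      + M ℤ.* up ℤ.1ℤ (pt s) j             ≡⟨ κ-coord s j ⟨
      comb v (κ s) j                       ≡⟨ comb-cong v κ≡single j ⟩
      comb v (single i (κ s i)) j          ≡⟨ comb-single v i (κ s i) j ⟩
      κ s i ℤ.* up ℤ.1ℤ (v i) j            ≡⟨ cong (ℤ._* up ℤ.1ℤ (v i) j) κ≡M ⟩
      + M ℤ.* up ℤ.1ℤ (v i) j              ∎))
    where
    open ≡-Reasoning
    instance
      Ws≢0 : ℤ.NonZero (W s)
      Ws≢0 = ℤ.≢-nonZero W≢0
    weighted : ∀ j → comb v (λ l → Σℤ.sum (λ s → W s ℤ.* κ s l)) j ≡ comb v (single i (+ M ℤ.* + N)) j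
    weighted j = begin
      comb v (λ l → Σℤ.sum (λ s → W s ℤ.* κ s l)) j                    ≡⟨ comb-sum v W κ j ⟩
      Σℤ.sum (λ s → W s ℤ.* comb v (κ s) j)                            ≡⟨ Σℤ.sum-cong-≗ (λ s → trans (cong (W s ℤ.*_) (κ-coord s j)) (swap (W s) (+ M) (up ℤ.1ℤ (pt s) j))) ⟩
      Σℤ.sum (λ s → + M ℤ.* (W s ℤ.* up ℤ.1ℤ (pt s) j))                ≡⟨ Σℤ.*-distribˡ-sum (+ M) (λ s → W s ℤ.* up ℤ.1ℤ (pt s) j) ⟨
      + M ℤ.* comb pt W j                                              ≡⟨ cong (+ M ℤ.*_) (W-coord j) ⟩
      + M ℤ.* (+ N ℤ.* up ℤ.1ℤ (v i) j)                                ≡⟨ ℤ.*-assoc (+ M) (+ N) (up ℤ.1ℤ (v i) j) ⟨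
      + M ℤ.* + N ℤ.* up ℤ.1ℤ (v i) j                                  ≡⟨ comb-single v i (+ M ℤ.* + N) j ⟨
      comb v (single i (+ M ℤ.* + N)) j                                ∎
      where
      swap : ∀ a b c → a ℤ.* (b ℤ.* c) ≡ b ℤ.* (a ℤ.* c)
      swap = ℤ-Solver.solve-∀
    κ≡0 : ∀ l → l ≢ i → κ s l ≡ ℤ.0ℤ
    κ≡0 l l≢i = ℤ.*-cancelˡ-≡ (W s) (κ s l) ℤ.0ℤ (trans
      (sum≡0⇒≡0 (λ s → 0≤i*j (0≤W s) (0≤κ s l)) (trans (comb-injective (λ l → Σℤ.sum (λ s → W s ℤ.* κ s l)) (single i (+ M ℤ.* + N)) weighted l) (single-other i l (+ M ℤ.* + N) l≢i)) s)
      (sym (ℤ.*-zeroʳ (W s))))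
    κ≡single : ∀ l → κ s l ≡ single i (κ s i) l
    κ≡single = ≡single (κ s) i κ≡0
    κ≡M : κ s i ≡ + M
    κ≡M = begin
      κ s i                                ≡⟨ ℤ.*-identityʳ (κ s i) ⟨
      κ s i ℤ.* ℤ.1ℤ                       ≡⟨ comb-single v i (κ s i) zero ⟨
      comb v (single i (κ s i)) zero       ≡⟨ comb-cong v κ≡single zero ⟨
      comb v (κ s) zero                    ≡⟨ κ-coord s zero ⟩
      + M ℤ.* ℤ.1ℤ                         ≡⟨ ℤ.*-identityʳ (+ M) ⟩
      + M                                  ∎

  -- A point with κ s i ≥ M is the vertex v i, which is congruent to 0 by itself.
  irreducible⇒κ<M : ∀ {s S} → Irreducible (s ∷ S) → ∀ i → κ s i ℤ.< + M
  irreducible⇒κ<M {s} {S} irr i = ℤ.≰⇒> λ M≤κ → irr {0} {1} (s≤s z≤n) (s≤s z≤n) (λ l → subst (+ M ∣_) (κ≡ M≤κ l) (M∣single i l))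
    where
    -- If κ s i ≥ M the excess is nonnegative with sum 0, hence zero, and the prefixes of lengths 0
    -- and 1 are congruent.
    excess : Fin (suc d) → ℤ
    excess l = κ s l ℤ.- single i (+ M) l
    0≤excess : + M ℤ.≤ κ s i → ∀ l → ℤ.0ℤ ℤ.≤ excess l
    0≤excess M≤κ l with l Fin.≟ i
    ... | yes refl = ℤ.i≤j⇒0≤j-i (subst (ℤ._≤ κ s l) (sym (single-same l (+ M))) M≤κ)
    ... | no l≢i = ℤ.i≤j⇒0≤j-i (subst (ℤ._≤ κ s l) (sym (single-other i l (+ M) l≢i)) (0≤κ s l))
    sum-excess : Σℤ.sum excess ≡ ℤ.0ℤ
    sum-excess = begin
      Σℤ.sum excess                                     ≡⟨ comb-height v excess ⟨
      comb v excess zero                                ≡⟨ comb-- v (κ s) (single i (+ M)) zero ⟩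
      comb v (κ s) zero ℤ.- comb v (single i (+ M)) zero ≡⟨ ℤ.i≡j⇒i-j≡0 (trans (κ-coord s zero) (sym (comb-single v i (+ M) zero))) ⟩
      ℤ.0ℤ                                              ∎
      where open ≡-Reasoning
    κ≡ : + M ℤ.≤ κ s i → ∀ l → single i (+ M) l ≡ (κ s l ℤ.+ ℤ.0ℤ) ℤ.- ℤ.0ℤ
    κ≡ M≤κ l = trans (sym (ℤ.i-j≡0⇒i≡j (κ s l) (single i (+ M) l) (sum≡0⇒≡0 (0≤excess M≤κ) sum-excess l))) (lem (κ s l))
      where
      lem : ∀ x → x ≡ (x ℤ.+ + 0) ℤ.- + 0
      lem = ℤ-Solver.solve-∀

  κ≤M : ∀ s i → κ s i ℤ.≤ + M
  κ≤M s i = subst (κ s i ℤ.≤_) (sum-κ s) (term≤sum (0≤κ s) i)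

  -- Strictness at the head is enough; the other points contribute at most M each. It is what
  -- excludes the boundary case h = (d+1)(|S| - 1).
  irreducible⇒coord< : ∀ {s S} → Irreducible (s ∷ S) → ∀ i → coord (s ∷ S) i ℤ.< + M ℤ.* + suc (length S)
  irreducible⇒coord< {s} {S} irr i = ℤ.<-≤-trans
    (ℤ.+-mono-<-≤ (irreducible⇒κ<M irr i) (total-≤ (λ s → κ≤M s i) S))
    (ℤ.≤-reflexive (lem (+ M) (+ length S)))
    where
    lem : ∀ m n → m ℤ.+ m ℤ.* n ≡ m ℤ.* (+ 1 ℤ.+ n)
    lem = ℤ-Solver.solve-∀

  -- A negative integer is at most -1, so M·c ≤ -M, and the chain M·h < (d+1)·M·(|S| - 1) ≤ M·h
  -- closes on itself.
  irreducible⇒0≤coefficient : ∀ {S} → Irreducible S → ∀ i h {c} →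
    + suc d ℤ.* + suc (length S) ℤ.≤ + h ℤ.+ + 2 ℤ.+ + (2 * d) →
    + M ℤ.* + h ℤ.≤ + suc d ℤ.* (coord S i ℤ.+ + M ℤ.* c) → ℤ.0ℤ ℤ.≤ c
  irreducible⇒0≤coefficient {S} irr i h {c} h-large L-large = ℤ.≮⇒≥ (λ c<0 → impossible S irr h-large L-large (≤-M c<0))
    where
    ≤-M : c ℤ.< ℤ.0ℤ → + M ℤ.* c ℤ.≤ ℤ.- (+ M)
    ≤-M c<0 = ℤ.≤-trans (ℤ.*-monoˡ-≤-nonNeg (+ M) (ℤ.i<j⇒i≤pred[j] c<0)) (ℤ.≤-reflexive (lem (+ M)))
      where
      lem : ∀ m → m ℤ.* (ℤ.- + 1 ℤ.+ + 0) ≡ ℤ.- m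
      lem = ℤ-Solver.solve-∀
    impossible : ∀ S → Irreducible S → + suc d ℤ.* + suc (length S) ℤ.≤ + h ℤ.+ + 2 ℤ.+ + (2 * d) →
      + M ℤ.* + h ℤ.≤ + suc d ℤ.* (coord S i ℤ.+ + M ℤ.* c) → ¬ (+ M ℤ.* c ℤ.≤ ℤ.- (+ M))
    -- Without a first point the strict inequality comes from -M < 0 and h ≥ 0 instead.
    impossible [] _ _ L-large Mc≤-M = ℤ.<-irrefl refl (begin-strict
      ℤ.0ℤ                                  ≤⟨ 0≤+*z M (+≤+ z≤n) ⟩
      + M ℤ.* + h                           ≤⟨ L-large ⟩
      + suc d ℤ.* (ℤ.0ℤ ℤ.+ + M ℤ.* c)      ≤⟨ ℤ.*-monoˡ-≤-nonNeg (+ suc d) (ℤ.+-monoʳ-≤ ℤ.0ℤ Mc≤-M) ⟩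
      + suc d ℤ.* (ℤ.0ℤ ℤ.+ ℤ.- (+ M))      <⟨ ℤ.*-monoˡ-<-pos (+ suc d) (ℤ.+-monoʳ-< ℤ.0ℤ (ℤ.neg-mono-< (ℤ.positive⁻¹ (+ M)))) ⟩
      + suc d ℤ.* (ℤ.0ℤ ℤ.+ ℤ.0ℤ)           ≡⟨ ℤ.*-zeroʳ (+ suc d) ⟩
      ℤ.0ℤ                                  ∎)
      where open ℤ.≤-Reasoning
    impossible (s ∷ S) irr h-large L-large Mc≤-M = ℤ.<-irrefl refl (begin-strict
      + M ℤ.* + h                                               ≤⟨ L-large ⟩
      + suc d ℤ.* (coord (s ∷ S) i ℤ.+ + M ℤ.* c)               <⟨ ℤ.*-monoˡ-<-pos (+ suc d) (ℤ.+-mono-<-≤ (irreducible⇒coord< irr i) Mc≤-M) ⟩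
      + suc d ℤ.* (+ M ℤ.* + k ℤ.+ ℤ.- (+ M))                   ≡⟨ lem₁ (+ M) (+ d) (+ k) ⟩
      + M ℤ.* (+ suc d ℤ.* + suc k ℤ.- (+ 2 ℤ.+ + 2 ℤ.* + d))   ≤⟨ ℤ.*-monoˡ-≤-nonNeg (+ M) (ℤ.+-monoˡ-≤ (ℤ.- (+ 2 ℤ.+ + 2 ℤ.* + d)) h-large) ⟩
      + M ℤ.* (+ h ℤ.+ + 2 ℤ.+ + (2 * d) ℤ.- (+ 2 ℤ.+ + 2 ℤ.* + d)) ≡⟨ cong (λ z → + M ℤ.* (+ h ℤ.+ + 2 ℤ.+ z ℤ.- (+ 2 ℤ.+ + 2 ℤ.* + d))) (ℤ.pos-* 2 d) ⟩
      + M ℤ.* (+ h ℤ.+ + 2 ℤ.+ + 2 ℤ.* + d ℤ.- (+ 2 ℤ.+ + 2 ℤ.* + d)) ≡⟨ lem₂ (+ M) (+ h) (+ d) ⟩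
      + M ℤ.* + h                                               ∎)
      where
      open ℤ.≤-Reasoning
      k = suc (length S)
      lem₁ : ∀ m d n → (+ 1 ℤ.+ d) ℤ.* (m ℤ.* n ℤ.+ ℤ.- m) ≡ m ℤ.* ((+ 1 ℤ.+ d) ℤ.* (+ 1 ℤ.+ n) ℤ.- (+ 2 ℤ.+ + 2 ℤ.* d))
      lem₁ = ℤ-Solver.solve-∀
      lem₂ : ∀ m h d → m ℤ.* (h ℤ.+ + 2 ℤ.+ + 2 ℤ.* d ℤ.- (+ 2 ℤ.+ + 2 ℤ.* d)) ≡ m ℤ.* h
      lem₂ = ℤ-Solver.solve-∀

-- Comparison with the volume

-- Taking ε = 1/m reduces the passage to the infimum to `archimedean`, with error `f`.
≤-limit : ∀ {a f vol} → 0ℚ ℚ.≤ f →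
  (∀ ε → 0ℚ ℚ.< ε → ∃[ t ] (t ℚ.≤ vol ℚ.+ ε × a ℚ.≤ f ℚ.* t)) → a ℚ.≤ f ℚ.* vol
≤-limit {a} {f} {vol} 0≤f approx = archimedean {C = f} bound
  where
  bound : ∀ m .{{_ : NonZero m}} → fromℕ m ℚ.* a ℚ.≤ fromℕ m ℚ.* (f ℚ.* vol) ℚ.+ f
  bound m = begin
    q ℚ.* a                                ≤⟨ q*-mono a≤ft ⟩
    q ℚ.* (f ℚ.* t)                        ≤⟨ q*-mono (ℚ.*-monoˡ-≤-nonNeg f {{ℚ.nonNegative 0≤f}} t≤) ⟩
    q ℚ.* (f ℚ.* (vol ℚ.+ ε))              ≡⟨ lem q f vol ε ⟩
    q ℚ.* (f ℚ.* vol) ℚ.+ f ℚ.* (q ℚ.* ε)  ≡⟨ cong (λ z → q ℚ.* (f ℚ.* vol) ℚ.+ f ℚ.* z) (proj₂ (proj₂ (recip m))) ⟩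
    q ℚ.* (f ℚ.* vol) ℚ.+ f ℚ.* 1ℚ         ≡⟨ cong (q ℚ.* (f ℚ.* vol) ℚ.+_) (ℚ.*-identityʳ f) ⟩
    q ℚ.* (f ℚ.* vol) ℚ.+ f                ∎
    where
    open ℚ.≤-Reasoning
    q = fromℕ m
    q*-mono : ∀ {x y} → x ℚ.≤ y → q ℚ.* x ℚ.≤ q ℚ.* y
    q*-mono = ℚ.*-monoˡ-≤-nonNeg q {{ℚ.nonNegative (0≤fromℕ m)}}
    ε = proj₁ (recip m)
    A = approx ε (proj₁ (proj₂ (recip m)))
    t = proj₁ A
    t≤ = proj₁ (proj₂ A)
    a≤ft = proj₂ (proj₂ A)
    lem : ∀ q f v e → q ℚ.* (f ℚ.* (v ℚ.+ e)) ≡ q ℚ.* (f ℚ.* v) ℚ.+ f ℚ.* (q ℚ.* e)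
    lem = Solver.solve-∀ ℚ-ring

∈ᴮ⇒InDilate : ∀ {d} H {t} → fromℕ H ℚ.* t ≡ 1ℚ → (y : Vec ℤ d) (B : Box d) → scale t y ∈ᴮ B → InDilate H y B
∈ᴮ⇒InDilate H {t} Ht≡1 y B inside j =
  subst (fromℕ H ℚ.* lower B j ℚ.≤_) H*y≡ (H*-mono (proj₁ (inside j))) ,
  subst (ℚ._≤ fromℕ H ℚ.* upper B j) H*y≡ (H*-mono (proj₂ (inside j)))
  where
  H*-mono : ∀ {x z} → x ℚ.≤ z → fromℕ H ℚ.* x ℚ.≤ fromℕ H ℚ.* z
  H*-mono = ℚ.*-monoˡ-≤-nonNeg (fromℕ H) {{ℚ.nonNegative (0≤fromℕ H)}}
  lem : ∀ h z t → h ℚ.* (z ℚ.* t) ≡ (h ℚ.* t) ℚ.* z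
  lem = Solver.solve-∀ ℚ-ring
  H*y≡ : fromℕ H ℚ.* lookup (scale t y) j ≡ toℚ (lookup y j)
  H*y≡ = begin
    fromℕ H ℚ.* lookup (scale t y) j          ≡⟨ cong (fromℕ H ℚ.*_) (Vec.lookup-map j (λ z → toℚ z ℚ.* t) y) ⟩
    fromℕ H ℚ.* (toℚ (lookup y j) ℚ.* t)      ≡⟨ lem (fromℕ H) (toℚ (lookup y j)) t ⟩
    fromℕ H ℚ.* t ℚ.* toℚ (lookup y j)        ≡⟨ cong (ℚ._* toℚ (lookup y j)) Ht≡1 ⟩
    1ℚ ℚ.* toℚ (lookup y j)                   ≡⟨ ℚ.*-identityˡ _ ⟩
    toℚ (lookup y j)                          ∎
    where open ≡-Reasoning

-- Multiplying the bound on n by d + 1 turns d! into (d+1)!, the factor in the hypothesis on h.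
volume-bound : ∀ d n h {vol} → fromℕ (suc n) ℚ.≤ fromℕ (d !) ℚ.* vol →
  fromℤ (+ h) ℚ.≥ vol ℚ.* fromℤ (+ (suc d !)) ℚ.- fromℤ (+ 2) ℚ.- fromℤ (+ (2 * d)) →
  + suc d ℤ.* + suc n ℤ.≤ + h ℤ.+ + 2 ℤ.+ + (2 * d)
volume-bound d n h {vol} n<d!vol h≥ = toℚ-cancel-≤ (begin
  toℚ (+ suc d ℤ.* + suc n)                  ≡⟨ toℚ-* (+ suc d) (+ suc n) ⟩
  fromℕ (suc d) ℚ.* fromℕ (suc n)            ≤⟨ ℚ.*-monoˡ-≤-nonNeg (fromℕ (suc d)) {{ℚ.nonNegative (0≤fromℕ (suc d))}} n<d!vol ⟩
  fromℕ (suc d) ℚ.* (fromℕ (d !) ℚ.* vol)    ≡⟨ lem₁ (fromℕ (suc d)) (fromℕ (d !)) vol ⟩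
  vol ℚ.* (fromℕ (suc d) ℚ.* fromℕ (d !))    ≡⟨ cong (vol ℚ.*_) (fromℕ-* (suc d) (d !)) ⟨
  vol ℚ.* fromℕ (suc d !)                    ≡⟨ lem₂ (vol ℚ.* fromℕ (suc d !)) (fromℕ 2) (fromℕ (2 * d)) ⟩
  vol ℚ.* fromℕ (suc d !) ℚ.- fromℕ 2 ℚ.- fromℕ (2 * d) ℚ.+ fromℕ 2 ℚ.+ fromℕ (2 * d)
                                             ≤⟨ ℚ.+-monoˡ-≤ (fromℕ (2 * d)) (ℚ.+-monoˡ-≤ (fromℕ 2) h≥′) ⟩
  fromℕ h ℚ.+ fromℕ 2 ℚ.+ fromℕ (2 * d)      ≡⟨ cong (ℚ._+ fromℕ (2 * d)) (toℚ-+ (+ h) (+ 2)) ⟨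
  toℚ (+ h ℤ.+ + 2) ℚ.+ fromℕ (2 * d)        ≡⟨ toℚ-+ (+ h ℤ.+ + 2) (+ (2 * d)) ⟨
  toℚ (+ h ℤ.+ + 2 ℤ.+ + (2 * d))            ∎)
  where
  open ℚ.≤-Reasoning
  lem₁ : ∀ e f v → e ℚ.* (f ℚ.* v) ≡ v ℚ.* (e ℚ.* f)
  lem₁ = Solver.solve-∀ ℚ-ring
  lem₂ : ∀ x a b → x ≡ x ℚ.- a ℚ.- b ℚ.+ a ℚ.+ b
  lem₂ = Solver.solve-∀ ℚ-ring
  h≥′ : vol ℚ.* fromℕ (suc d !) ℚ.- fromℕ 2 ℚ.- fromℕ (2 * d) ℚ.≤ fromℕ h
  h≥′ = subst₂ ℚ._≤_
    (cong₂ ℚ._-_ (cong₂ (λ x y → vol ℚ.* x ℚ.- y) (fromℤ≡toℚ (+ (suc d !))) (fromℤ≡toℚ (+ 2))) (fromℤ≡toℚ (+ (2 * d))))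
    (fromℤ≡toℚ (+ h)) h≥

-- Sumsets of `A` in homogeneous coordinates

module _ {d : ℕ} (A : List (Vec ℤ d)) where

  -- The number of summands is existential and recoverable from the height, so the closure
  -- properties need no bookkeeping of it.
  Attained : (Fin (suc d) → ℤ) → Set
  Attained y = ∃[ k ] ∃[ x ] ((k ·ˢ ⟦ A ⟧) x × (∀ j → y j ≡ up (+ k) x j))

  attained-resp : ∀ {y z} → (∀ j → y j ≡ z j) → Attained z → Attained y
  attained-resp eq (k , x , x∈kA , eq′) = k , x , x∈kA , λ j → trans (eq j) (eq′ j)

  attained-zero : Attained (λ _ → ℤ.0ℤ)
  attained-zero = 0 , 0ᵛ , ([] , [] , refl) , λ { zero → refl ; (suc j) → sym (Vec.lookup-replicate j ℤ.0ℤ) }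

  attained-cons : ∀ {a y} → a ∈ A → Attained y → Attained (λ j → up ℤ.1ℤ a j ℤ.+ y j)
  attained-cons {a} a∈A (k , x , (b , b∈A , x≡) , eq) =
    suc k , a +ᵛ x , (a ∷ b , a∈A ∷ b∈A , cong (a +ᵛ_) x≡)
    , λ j → trans (cong (ℤ._+_ (up ℤ.1ℤ a j)) (eq j)) (sym (up-+ ℤ.1ℤ (+ k) a x j))

  attained-multiple : ∀ {a y} → a ∈ A → ∀ n → Attained y → Attained (λ j → + n ℤ.* up ℤ.1ℤ a j ℤ.+ y j)
  attained-multiple {a} {y} a∈A zero    att = attained-resp (λ j → ℤ.+-identityˡ (y j)) att
  attained-multiple {a} {y} a∈A (suc n) att = attained-resp (λ j → lem (+ n) (up ℤ.1ℤ a j) (y j))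
    (attained-cons a∈A (attained-multiple a∈A n att))
    where
    lem : ∀ n u y → (+ 1 ℤ.+ n) ℤ.* u ℤ.+ y ≡ u ℤ.+ (n ℤ.* u ℤ.+ y)
    lem = ℤ-Solver.solve-∀

  attained-comb : ∀ {n y} (p : Fin n → Vec ℤ d) → (∀ i → p i ∈ A) → ∀ c → (∀ i → ℤ.0ℤ ℤ.≤ c i) →
    Attained y → Attained (λ j → comb p c j ℤ.+ y j)
  attained-comb {zero}  {y} p p∈A c 0≤c att = attained-resp (λ j → ℤ.+-identityˡ (y j)) att
  attained-comb {suc n} {y} p p∈A c 0≤c att = attained-resp
    (λ j → trans (ℤ.+-assoc (c zero ℤ.* up ℤ.1ℤ (p zero) j) (comb (p ∘ suc) (c ∘ suc) j) (y j))
      (cong (λ z → z ℤ.* up ℤ.1ℤ (p zero) j ℤ.+ (comb (p ∘ suc) (c ∘ suc) j ℤ.+ y j)) (sym (ℤ.0≤i⇒+∣i∣≡i (0≤c zero)))))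
    (attained-multiple (p∈A zero) ℤ.∣ c zero ∣ (attained-comb (p ∘ suc) (p∈A ∘ suc) (c ∘ suc) (0≤c ∘ suc) att))

  attained-total : ∀ {a y} (p : Fin a → Vec ℤ d) → (∀ i → p i ∈ A) → ∀ S →
    Attained y → Attained (λ j → total (λ s → up ℤ.1ℤ (p s) j) S ℤ.+ y j)
  attained-total {y = y} p p∈A []      att = attained-resp (λ j → ℤ.+-identityˡ (y j)) att
  attained-total {y = y} p p∈A (s ∷ S) att = attained-resp
    (λ j → ℤ.+-assoc (up ℤ.1ℤ (p s) j) (total (λ s → up ℤ.1ℤ (p s) j) S) (y j))
    (attained-cons (p∈A s) (attained-total p p∈A S att))

  attained⇒∈ : ∀ {h x} → Attained (up (+ h) x) → (h ·ˢ ⟦ A ⟧) x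
  attained⇒∈ {h} {x} (k , x′ , x′∈kA , eq) =
    subst₂ (λ h x → (h ·ˢ ⟦ A ⟧) x) (sym (ℤ.+-injective (eq zero))) (sym (up-injective {m = + h} {+ k} eq)) x′∈kA

  shift : Vec ℤ d → ∀ {k} → Vec (Vec ℤ d) k → Vec (Vec ℤ d) k
  shift u = Vec.map (_-ᵛ u)

  lookup-·ᵛ : ∀ k (u : Vec ℤ d) j → lookup (k ·ᵛ u) j ≡ + k ℤ.* lookup u j
  lookup-·ᵛ k u j = Vec.lookup-map j (+ k ℤ.*_) u

  sum-shift : ∀ u {k} (b : Vec (Vec ℤ d) k) → sumᵛ b ≡ (k ·ᵛ u) +ᵛ sumᵛ (shift u b)
  sum-shift u {k} b = lookup-ext λ j → trans (go b j)
    (sym (trans (Vec.lookup-zipWith ℤ._+_ j (k ·ᵛ u) (sumᵛ (shift u b))) (cong (ℤ._+ lookup (sumᵛ (shift u b)) j) (lookup-·ᵛ k u j))))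
    where
    open ≡-Reasoning
    lem₁ : ∀ u → + 0 ≡ + 0 ℤ.* u ℤ.+ + 0
    lem₁ = ℤ-Solver.solve-∀
    lem₂ : ∀ a k u s → a ℤ.+ (k ℤ.* u ℤ.+ s) ≡ (+ 1 ℤ.+ k) ℤ.* u ℤ.+ ((a ℤ.- u) ℤ.+ s)
    lem₂ = ℤ-Solver.solve-∀
    go : ∀ {k} (b : Vec (Vec ℤ d) k) j → lookup (sumᵛ b) j ≡ + k ℤ.* lookup u j ℤ.+ lookup (sumᵛ (shift u b)) j
    go [] j = begin
      lookup 0ᵛ j                                 ≡⟨ Vec.lookup-replicate j ℤ.0ℤ ⟩
      + 0                                         ≡⟨ lem₁ (lookup u j) ⟩
      + 0 ℤ.* lookup u j ℤ.+ + 0                  ≡⟨ cong (ℤ._+_ (+ 0 ℤ.* lookup u j)) (Vec.lookup-replicate j ℤ.0ℤ) ⟨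
      + 0 ℤ.* lookup u j ℤ.+ lookup 0ᵛ j          ∎
    go {suc k} (a ∷ b) j = begin
      lookup (a +ᵛ sumᵛ b) j                                                     ≡⟨ Vec.lookup-zipWith ℤ._+_ j a (sumᵛ b) ⟩
      lookup a j ℤ.+ lookup (sumᵛ b) j                                           ≡⟨ cong (ℤ._+_ (lookup a j)) (go b j) ⟩
      lookup a j ℤ.+ (+ k ℤ.* lookup u j ℤ.+ lookup (sumᵛ (shift u b)) j)        ≡⟨ lem₂ (lookup a j) (+ k) (lookup u j) (lookup (sumᵛ (shift u b)) j) ⟩
      + suc k ℤ.* lookup u j ℤ.+ ((lookup a j ℤ.- lookup u j) ℤ.+ lookup (sumᵛ (shift u b)) j)
        ≡⟨ cong (λ z → + suc k ℤ.* lookup u j ℤ.+ (z ℤ.+ lookup (sumᵛ (shift u b)) j)) (Vec.lookup-zipWith ℤ._-_ j a u) ⟨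
      + suc k ℤ.* lookup u j ℤ.+ (lookup (a -ᵛ u) j ℤ.+ lookup (sumᵛ (shift u b)) j)
        ≡⟨ cong (ℤ._+_ (+ suc k ℤ.* lookup u j)) (Vec.lookup-zipWith ℤ._+_ j (a -ᵛ u) (sumᵛ (shift u b))) ⟨
      + suc k ℤ.* lookup u j ℤ.+ lookup (sumᵛ (shift u (a ∷ b))) j               ∎

  hA⊆h·u+T : ∀ u {h x} → (h ·ˢ ⟦ A ⟧) x → ((h ·ᵛ u) +ˢ T A u) x
  hA⊆h·u+T u {h} (b , b∈A , refl) = sumᵛ (shift u b)
    , (h , shift u b , VecAll.map⁺ (VecAll.map (λ {a} a∈A → a , a∈A , refl) b∈A) , refl) , sum-shift u b

  -- Differences a - u have height 0; adding k homogenised copies of u restores k homogenised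
  -- elements of A.
  unshift : ∀ u {k} (b : Vec (Vec ℤ d) k) → VecAll.All (⟦ A ⟧ -ˢ u) b →
    ∃[ S ] (∀ j → total (λ s → up ℤ.1ℤ (List.lookup A s) j) S ≡ up ℤ.0ℤ (sumᵛ b) j ℤ.+ + k ℤ.* up ℤ.1ℤ u j)
  unshift u [] [] = [] , λ { zero → refl ; (suc j) → trans (lem (lookup u j)) (cong (ℤ._+ + 0 ℤ.* lookup u j) (sym (Vec.lookup-replicate j ℤ.0ℤ))) }
    where
    lem : ∀ u → + 0 ≡ + 0 ℤ.+ + 0 ℤ.* u
    lem = ℤ-Solver.solve-∀
  unshift u {suc k} (q ∷ b) ((a , a∈A , q≡) ∷ b∈) = Any.index a∈A ∷ S , λ j → begin
    up ℤ.1ℤ (List.lookup A (Any.index a∈A)) j ℤ.+ total (λ s → up ℤ.1ℤ (List.lookup A s) j) S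
      ≡⟨ cong₂ ℤ._+_ (cong (λ x → up ℤ.1ℤ x j) (sym (Any.lookup-index a∈A))) (eq j) ⟩
    up ℤ.1ℤ a j ℤ.+ (up ℤ.0ℤ (sumᵛ b) j ℤ.+ + k ℤ.* up ℤ.1ℤ u j)
      ≡⟨ cong (ℤ._+ (up ℤ.0ℤ (sumᵛ b) j ℤ.+ + k ℤ.* up ℤ.1ℤ u j)) (a≡ j) ⟩
    up ℤ.0ℤ q j ℤ.+ up ℤ.1ℤ u j ℤ.+ (up ℤ.0ℤ (sumᵛ b) j ℤ.+ + k ℤ.* up ℤ.1ℤ u j)
      ≡⟨ lem₂ (up ℤ.0ℤ q j) (up ℤ.1ℤ u j) (up ℤ.0ℤ (sumᵛ b) j) (+ k) ⟩
    up ℤ.0ℤ q j ℤ.+ up ℤ.0ℤ (sumᵛ b) j ℤ.+ + suc k ℤ.* up ℤ.1ℤ u j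
      ≡⟨ cong (ℤ._+ + suc k ℤ.* up ℤ.1ℤ u j) (up-+ ℤ.0ℤ ℤ.0ℤ q (sumᵛ b) j) ⟨
    up ℤ.0ℤ (sumᵛ (q ∷ b)) j ℤ.+ + suc k ℤ.* up ℤ.1ℤ u j ∎
    where
    open ≡-Reasoning
    S = proj₁ (unshift u b b∈)
    eq = proj₂ (unshift u b b∈)
    lem₁ : ∀ a u → a ≡ (a ℤ.- u) ℤ.+ u
    lem₁ = ℤ-Solver.solve-∀
    lem₂ : ∀ q u s k → q ℤ.+ u ℤ.+ (s ℤ.+ k ℤ.* u) ≡ q ℤ.+ s ℤ.+ (+ 1 ℤ.+ k) ℤ.* u
    lem₂ = ℤ-Solver.solve-∀
    a≡ : ∀ j → up ℤ.1ℤ a j ≡ up ℤ.0ℤ q j ℤ.+ up ℤ.1ℤ u j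
    a≡ zero    = refl
    a≡ (suc j) = trans (lem₁ (lookup a j) (lookup u j))
      (cong (ℤ._+ lookup u j) (sym (trans (cong (λ q → lookup q j) q≡) (Vec.lookup-zipWith ℤ._-_ j a u))))

-- The intersection lies in the sumset

module SimplexVertices {d : ℕ} (A : List (Vec ℤ d)) (v : Fin (suc d) → Vec ℤ d)
  (independent : ∀ c → (∀ j → comb v c j ≡ ℤ.0ℤ) → ∀ i → c i ≡ ℤ.0ℤ)
  (M : ℕ) .{{M≢0 : NonZero M}}
  (κ : Fin (length A) → Fin (suc d) → ℤ) (0≤κ : ∀ s i → ℤ.0ℤ ℤ.≤ κ s i)
  (κ-coord : ∀ s j → comb v (κ s) j ≡ + M ℤ.* up ℤ.1ℤ (List.lookup A s) j)
  where
  open Simplex v (List.lookup A) independent M κ 0≤κ κ-coord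

  vertex∈A : (∀ x → Conv (ι ∘ v) x → Δ A x) → ∀ i → v i ∈ A
  vertex∈A Conv⊆Δ i = subst (_∈ A) (proj₂ found) (∈-lookup (proj₁ found))
    where
    bary = Conv⇒BaryCoord (List.lookup A) (v i) (Conv⊆Δ (ι (v i)) (point∈Conv v i))
    found = vertex-occurs i (proj₁ bary) {{proj₁ (proj₂ bary)}} (proj₂ (proj₂ bary))

  irreducible⇒length<d!vol : ∀ {vol} → (∀ x → Conv (ι ∘ v) x → Δ A x) → IsVolume (Δ A) vol → ∀ {S} → Irreducible S → fromℕ (suc (length S)) ℚ.≤ fromℕ (d !) ℚ.* vol
  irreducible⇒length<d!vol Conv⊆Δ (_ , approximate) {S} irr = ≤-limit (0≤fromℕ (d !)) λ ε 0<ε →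
    let Bs , covers , small = approximate ε 0<ε
    in totalVolume Bs , small , latticeCount⇒volume≥ Bs (suc (length S)) (length S)
         (latticePoint S) (λ m → latticePoint-injective S irr m) (λ m k j → inBoxes Bs covers m k j)
    where
    inBoxes : ∀ Bs → Covers Bs (Δ A) → ∀ m .{{_ : NonZero m}} k j →
      Any (InDilate (m ℕ.+ length S) (latticePoint S m k j)) Bs
    -- Divided by its height H, the lattice point has nonnegative barycentric coordinates, so it
    -- lies in the hull and some box of the cover contains it.
    inBoxes Bs covers m k j = Any.map (λ {B} → ∈ᴮ⇒InDilate H Ht≡1 y B)
      (covers (scale t y) (Conv⊆Δ (scale t y) (comb-nonNeg⇒Conv v (latticeCoord S m k j) (0≤latticeCoord S m k j) M H
        (ℚ.<⇒≤ 0<t) Ht≡1 y (latticePoint-coord S m k j))))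
      where
      y = latticePoint S m k j
      H = m ℕ.+ length S
      instance
        H≢0 : NonZero H
        H≢0 = ℕ.>-nonZero (ℕ.≤-trans (ℕ.>-nonZero⁻¹ m) (ℕ.m≤m+n m (length S)))
      t = proj₁ (recip H)
      0<t = proj₁ (proj₂ (recip H))
      Ht≡1 = proj₂ (proj₂ (recip H))

  T⇒Represents : ∀ {h x} i → ((h ·ᵛ v i) +ˢ T A (v i)) x → ∃[ S ] Represents i (up (+ h) x) S
  T⇒Represents {h} {x} i (s , (k , b , b∈ , s≡) , x≡) = S , single i r , 0≤ , eq
    where
    open ≡-Reasoning
    S = proj₁ (unshift A (v i) b b∈)
    -- The k elements of A have height k; this coefficient of `v i` corrects it to h and is negative
    -- when k > h.
    r = + h ℤ.- + k
    0≤ : ∀ l → l ≢ i → ℤ.0ℤ ℤ.≤ single i r l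
    0≤ l l≢i = ℤ.≤-reflexive (sym (single-other i l r l≢i))
    x≡′ : ∀ j → up (+ h) x j ≡ + h ℤ.* up ℤ.1ℤ (v i) j ℤ.+ up ℤ.0ℤ (sumᵛ b) j
    x≡′ zero    = sym (trans (ℤ.+-identityʳ (+ h ℤ.* ℤ.1ℤ)) (ℤ.*-identityʳ (+ h)))
    x≡′ (suc j) = begin
      lookup x j                                           ≡⟨ cong (λ x → lookup x j) (trans x≡ (cong ((h ·ᵛ v i) +ᵛ_) s≡)) ⟩
      lookup ((h ·ᵛ v i) +ᵛ sumᵛ b) j                      ≡⟨ Vec.lookup-zipWith ℤ._+_ j (h ·ᵛ v i) (sumᵛ b) ⟩
      lookup (h ·ᵛ v i) j ℤ.+ lookup (sumᵛ b) j            ≡⟨ cong (ℤ._+ lookup (sumᵛ b) j) (lookup-·ᵛ A h (v i) j) ⟩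
      + h ℤ.* lookup (v i) j ℤ.+ lookup (sumᵛ b) j         ∎
    lem : ∀ h u s k → h ℤ.* u ℤ.+ s ≡ (s ℤ.+ k ℤ.* u) ℤ.+ (h ℤ.- k) ℤ.* u
    lem = ℤ-Solver.solve-∀
    eq : ∀ j → up (+ h) x j ≡ pos S j ℤ.+ comb v (single i r) j
    eq j = begin
      up (+ h) x j                                                              ≡⟨ x≡′ j ⟩
      + h ℤ.* up ℤ.1ℤ (v i) j ℤ.+ up ℤ.0ℤ (sumᵛ b) j                            ≡⟨ lem (+ h) (up ℤ.1ℤ (v i) j) (up ℤ.0ℤ (sumᵛ b) j) (+ k) ⟩
      up ℤ.0ℤ (sumᵛ b) j ℤ.+ + k ℤ.* up ℤ.1ℤ (v i) j ℤ.+ r ℤ.* up ℤ.1ℤ (v i) j  ≡⟨ cong₂ ℤ._+_ (proj₂ (unshift A (v i) b b∈) j) (comb-single v i r j) ⟨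
      pos S j ℤ.+ comb v (single i r) j                                         ∎

  represented⇒∈ : (∀ i → v i ∈ A) → ∀ {h x i S} → Irreducible S →
    + suc d ℤ.* + suc (length S) ℤ.≤ + h ℤ.+ + 2 ℤ.+ + (2 * d) →
    (rep : Represents i (up (+ h) x) S) →
    + M ℤ.* + h ℤ.≤ + suc d ℤ.* (coord S i ℤ.+ + M ℤ.* proj₁ rep i) → (h ·ˢ ⟦ A ⟧) x
  represented⇒∈ v∈A {h} {x} {i} {S} irr h-large (c , 0≤c , eq) L-large = attained⇒∈ A (attained-resp A eq′
    (attained-total A (List.lookup A) ∈-lookup S (attained-comb A v v∈A c 0≤c′ (attained-zero A))))
    where
    0≤c′ : ∀ l → ℤ.0ℤ ℤ.≤ c l
    0≤c′ l with l Fin.≟ i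
    ... | yes refl = irreducible⇒0≤coefficient irr i h h-large L-large
    ... | no l≢i = 0≤c l l≢i
    eq′ : ∀ j → up (+ h) x j ≡ pos S j ℤ.+ (comb v c j ℤ.+ ℤ.0ℤ)
    eq′ j = trans (eq j) (cong (ℤ._+_ (pos S j)) (sym (ℤ.+-identityʳ (comb v c j))))

  ⋂⊆hA : (∀ i → v i ∈ A) → ∀ {h} →
    (∀ {S} → Irreducible S → + suc d ℤ.* + suc (length S) ℤ.≤ + h ℤ.+ + 2 ℤ.+ + (2 * d)) →
    ∀ {x} → (∀ i → ((h ·ᵛ v i) +ˢ T A (v i)) x) → (h ·ˢ ⟦ A ⟧) x
  ⋂⊆hA v∈A {h} h-large {x} x∈ = go (T⇒Represents {h} {x} zero (x∈ zero))
    where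
    go : ∃[ S ] Represents zero (up (+ h) x) S → (h ·ˢ ⟦ A ⟧) x
    go (S₀ , rep₀) = go′ (average≤max L)
      where
      L : Fin (suc d) → ℤ
      -- The representation at `zero` serves only to compute the coordinates of (h, x), from which
      -- the vertex i is chosen; the representation at i is reduced afterwards and has the same
      -- coordinates.
      L t = coord S₀ t ℤ.+ + M ℤ.* proj₁ rep₀ t
      L-coord : ∀ j → comb v L j ≡ + M ℤ.* up (+ h) x j
      L-coord = coordinates {zero} {up (+ h) x} {S₀} rep₀
      ΣL≡ : Σℤ.sum L ≡ + M ℤ.* + h
      ΣL≡ = trans (sym (comb-height v L)) (L-coord zero)
      go′ : (∃[ i ] Σℤ.sum L ℤ.≤ + suc d ℤ.* L i) → (h ·ˢ ⟦ A ⟧) x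
      go′ (i , avg) = go″ (reduce {i} {up (+ h) x} {proj₁ (T⇒Represents {h} {x} i (x∈ i))} (proj₂ (T⇒Represents {h} {x} i (x∈ i))))
        where
        go″ : ∃[ S ] (Irreducible S × Represents i (up (+ h) x) S) → (h ·ˢ ⟦ A ⟧) x
        go″ (S , irr , rep) = represented⇒∈ v∈A irr (h-large irr) rep
          (subst₂ (λ a b → a ℤ.≤ + suc d ℤ.* b) ΣL≡ L≡ avg)
          where
          L≡ : L i ≡ coord S i ℤ.+ + M ℤ.* proj₁ rep i
          L≡ = comb-injective L (λ t → coord S t ℤ.+ + M ℤ.* proj₁ rep t)
            (λ j → trans (L-coord j) (sym (coordinates {i} {up (+ h) x} {S} rep j))) i

theorem1p3 : (d : ℕ) (A : List (Vec ℤ d)) →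
    Generates (Differences ⟦ A ⟧) →
    (v : Fin (suc d) → Vec ℤ d) →
    IsSimplex (Δ A) (λ i → ι (v i)) →
    (vol : ℚ) → IsVolume (Δ A) vol →
    (h : ℕ) →
    fromℤ (+ h) ℚ.≥ vol ℚ.* fromℤ (+ (suc d !)) ℚ.- fromℤ (+ 2) ℚ.- fromℤ (+ (2 * d)) →
    (h ·ˢ ⟦ A ⟧) ≐ ⋂[ i ∶ Fin (suc d) ] ((h ·ᵛ v i) +ˢ T A (v i))
theorem1p3 d A _ v (affIndependent , Δ⊆Conv , Conv⊆Δ) vol isVolume h h-large =
  -- For the other inclusion, every element of A lies in the hull, hence in the simplex, and one
  -- denominator M is chosen for all their barycentric coordinates.
  (λ x∈hA i → hA⊆h·u+T A (v i) x∈hA) , backward (commonMultiple (λ s → BaryCoord v (List.lookup A s))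
    (λ s → baryCoord-multiple v (List.lookup A s))
    (λ s → Conv⇒BaryCoord v (List.lookup A s) (Δ⊆Conv {ι (List.lookup A s)} (point∈Conv (List.lookup A) s))))
  where
  backward : ∃[ M ] (NonZero M × (∀ s → BaryCoord v (List.lookup A s) M)) →
    ∀ {x} → (∀ i → ((h ·ᵛ v i) +ˢ T A (v i)) x) → (h ·ˢ ⟦ A ⟧) x
  backward (M , M≢0 , bary) = ⋂⊆hA (vertex∈A (λ x → Conv⊆Δ {x}))
    (λ {S} irr → volume-bound d (length S) h (irreducible⇒length<d!vol (λ x → Conv⊆Δ {x}) isVolume irr) h-large)
    where
    instance
      nonZero : NonZero M
      nonZero = M≢0
    open SimplexVertices A v (comb-independent v affIndependent) M (λ s → proj₁ (bary s))
      (λ s → proj₁ (proj₂ (bary s))) (λ s → proj₂ (proj₂ (bary s)))
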